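{- Let $\mathbb{L}_{\mathrm{strong}}$ be the set of strong Liouville numbers and let $\mathcal{L}$ be the set of Liouville numbers defined in the context. Then $\mathbb{L}_{\mathrm{strong}}\subseteq\mathcal{L}$, and $\mathcal{L}\setminus\mathbb{L}_{\mathrm{strong}}$ is an uncountable set.
   Context: A real irrational number $\xi$, with $(p_k/q_k)_k$ the sequence of convergents of its continued fraction, is a strong Liouville number if for every positive integer $n$ there exists $N$ (depending on $n$) such that $q_{k+1}>q_k^n$ for all $k>N$. For a rational number $p/q$ in lowest terms, $H(p/q)=\max\{|p|,|q|\}$. The set $\mathcal{L}$ consists of the real numbers $\xi$ for which there exist a sequence $(\omega_n)_{n\ge1}$ of positive real numbers with $\omega_n\to\infty$, a sequence of rational numbers $(p_n/q_n)_{n\ge 1}$ taking infinitely many distinct values, and a constant $C>0$ such that, for all $n\ge 1$, $|\xi-p_n/q_n|<H(p_n/q_n)^{ -\omega_n}$ and $H(p_{n+1}/q_{n+1})\le H(p_n/q_n)^{C\omega_n}$. -}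

module Defs where

open import Algebra.Bundles using (CommutativeRing)
open import Data.Empty using (⊥; ⊥-elim)
open import Data.Integer.Base as ℤ using (ℤ; +_; -[1+_])
import Data.Integer.Properties as ℤ
import Data.Integer.Tactic.RingSolver as ℤSolver
open import Data.List.Base using (List)
open import Data.List.Membership.Propositional using (_∉_)
open import Data.Nat.Base as ℕ using (ℕ; zero; suc; NonZero)
import Data.Nat.Properties as ℕ
open import Data.Nat.Coprimality as ℕ using (1-coprimeTo)
open import Data.Product.Base using (∃; ∃₂; Σ-syntax; ∃-syntax; _×_; _,_; proj₁; proj₂)
open import Data.Rational.Base as ℚ using (ℚ; mkℚ; 0ℚ; 1ℚ; ½; ↥_; ↧_; ↧ₙ_; *≤*; *<*)
import Data.Rational.Properties as ℚ
open import Data.Rational.Solver using (module +-*-Solver)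
import Data.Rational.Unnormalised.Base as ℚᵘ
import Data.Rational.Unnormalised.Properties as ℚᵘ
open import Data.Sum.Base using (_⊎_; inj₁; inj₂)
open import Function.Base using (_∘_)
open import Relation.Binary.Definitions using (tri<; tri≈; tri>)
open import Relation.Binary.PropositionalEquality
open import Relation.Nullary.Decidable.Core using (yes; no)
open import Relation.Nullary.Negation.Core using (¬_)
open import Relation.Unary using (Pred; _∈_)

open import Algebra.Definitions.RawSemiring ℚ.+-*-rawSemiring using (_^_)
open import Algebra.Properties.CommutativeSemiring.Exp
  (CommutativeRing.commutativeSemiring ℚ.+-*-commutativeRing)
  using (^-homo-*; ^-assocʳ; ^-distrib-*)
open import Algebra.Properties.CommutativeSemigroup
  (CommutativeRing.+-commutativeSemigroup ℚ.+-*-commutativeRing)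
  using (interchange)

private

  infixl 7 _*_
  infixl 6 _+_
  infix 4 _<_ _≤_

  _*_ _+_ : ℚ → ℚ → ℚ
  _*_ = ℚ._*_
  _+_ = ℚ._+_

  _<_ _≤_ : ℚ → ℚ → Set
  _<_ = ℚ._<_
  _≤_ = ℚ._≤_

  infixr 8 _·_

  _·_ : ℕ → ℚ → ℚ
  zero  · p = 0ℚ
  suc n · p = p + n · p

  opaque

    <-dense : ∀ {p q} → p < q → ∃[ m ] p < m × m < q
    <-dense p<q = ℚ.<-dense p<q

    0<1 : 0ℚ < 1ℚ
    0<1 = ℚ.positive⁻¹ 1ℚ

    p<p+ε : ∀ p {ε} → 0ℚ < ε → p < p + ε
    p<p+ε p 0<ε = subst (_< p + _) (ℚ.+-identityʳ p) (ℚ.+-monoʳ-< p 0<ε)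

    p≤p+ε : ∀ p {ε} → 0ℚ ≤ ε → p ≤ p + ε
    p≤p+ε p 0≤ε = subst (_≤ p + _) (ℚ.+-identityʳ p) (ℚ.+-monoʳ-≤ p 0≤ε)

    above : ∀ p → ∃[ q ] p < q
    above p = p + 1ℚ , p<p+ε p 0<1

    below : ∀ p → ∃[ q ] q < p
    below p = p ℚ.- 1ℚ , subst (p ℚ.- 1ℚ <_) (eq p) (p<p+ε (p ℚ.- 1ℚ) 0<1)
      where
      open +-*-Solver
      eq : ∀ p → p ℚ.- 1ℚ + 1ℚ ≡ p
      eq = solve 1 (λ p → p :- con 1ℚ :+ con 1ℚ := p) refl

    p+[q-p]≡q : ∀ p q → p + (q ℚ.- p) ≡ q
    p+[q-p]≡q = solve 2 (λ p q → p :+ (q :- p) := q) refl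
      where open +-*-Solver

    0<q-p : ∀ {p q} → p < q → 0ℚ < q ℚ.- p
    0<q-p {p} {q} p<q =
      subst (_< q ℚ.- p) (ℚ.+-inverseʳ p) (ℚ.+-monoˡ-< (ℚ.- p) p<q)

    *-pos : ∀ {p q} → 0ℚ < p → 0ℚ < q → 0ℚ < p * q
    *-pos {p} {q} 0<p 0<q =
      ℚ.positive⁻¹ (p * q)
        {{ℚ.pos*pos⇒pos p {{ℚ.positive 0<p}} q {{ℚ.positive 0<q}}}}

    *-mono-≤ : ∀ {p q r s} → 0ℚ ≤ p → 0ℚ ≤ s → p ≤ q → r ≤ s → p * r ≤ q * s
    *-mono-≤ {p} {q} {r} {s} 0≤p 0≤s p≤q r≤s = ℚ.≤-trans
      (ℚ.*-monoˡ-≤-nonNeg p {{ℚ.nonNegative 0≤p}} r≤s)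
      (ℚ.*-monoʳ-≤-nonNeg s {{ℚ.nonNegative 0≤s}} p≤q)

    *-mono-< : ∀ {p q r s} → 0ℚ < p → 0ℚ < s → p < q → r < s → p * r < q * s
    *-mono-< {p} {q} {r} {s} 0<p 0<s p<q r<s = ℚ.<-trans
      (ℚ.*-monoʳ-<-pos p {{ℚ.positive 0<p}} r<s)
      (ℚ.*-monoˡ-<-pos s {{ℚ.positive 0<s}} p<q)

  opaque

    quotient : ∀ p q → 0ℚ < q → ∃[ t ] t * q ≡ p
    quotient p q 0<q =
      p * (ℚ.1/ q) {{q≢0}} , trans (ℚ.*-assoc p ((ℚ.1/ q) {{q≢0}}) q)
        (trans (cong (p *_) (ℚ.*-inverseˡ q {{q≢0}})) (ℚ.*-identityʳ p))
      where
      q≢0 : ℚ.NonZero q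
      q≢0 = ℚ.>-nonZero 0<q

    ·-* : ∀ n p → (n · 1ℚ) * p ≡ n · p
    ·-* zero    p = ℚ.*-zeroˡ p
    ·-* (suc n) p = trans (ℚ.*-distribʳ-+ p 1ℚ (n · 1ℚ))
                          (cong₂ _+_ (ℚ.*-identityˡ p) (·-* n p))

    ·-nonNeg : ∀ n {p} → 0ℚ ≤ p → 0ℚ ≤ n · p
    ·-nonNeg zero    0≤p = ℚ.≤-refl
    ·-nonNeg (suc n) 0≤p = ℚ.≤-trans 0≤p (p≤p+ε _ (·-nonNeg n 0≤p))

    n·1 : ∀ n → n · 1ℚ ≡ mkℚ (+ n) 0 (ℕ.sym (1-coprimeTo n))
    n·1 zero    = refl
    n·1 (suc n) = trans (cong (λ x → 1ℚ + x) (n·1 n)) (ℚ.toℚᵘ-injective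
      (ℚᵘ.≃-trans (ℚ.toℚᵘ-homo-+ 1ℚ (mkℚ (+ n) 0 (ℕ.sym (1-coprimeTo n))))
        (ℚᵘ.*≡* (eq (+ n)))))
      where
      eq : ∀ m → (+ 1 ℤ.* + 1 ℤ.+ m ℤ.* + 1) ℤ.* + 1 ≡ (+ 1 ℤ.+ m) ℤ.* + 1
      eq = ℤSolver.solve-∀

    p≤n·1 : ∀ p → ∃[ n ] p ≤ n · 1ℚ
    p≤n·1 p@(mkℚ (+ a) d _) = a , subst (p ≤_) (sym (n·1 a))
      (*≤* (subst₂ ℤ._≤_ (sym (ℤ.*-identityʳ (+ a))) (ℤ.pos-* a (suc d))
        (ℤ.+≤+ (ℕ.m≤m*n a (suc d)))))
    p≤n·1 (mkℚ -[1+ a ] d _) = 0 , *≤* ℤ.-≤+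

  opaque

    archimedean : ∀ p {ε} → 0ℚ < ε → ∃[ n ] p ≤ n · ε
    archimedean p {ε} 0<ε with quotient p ε 0<ε
    ... | t , tε≡p with p≤n·1 t
    ... | n , t≤n = n , subst₂ _≤_ tε≡p (·-* n ε)
          (ℚ.*-monoʳ-≤-nonNeg ε {{ℚ.nonNegative (ℚ.<⇒≤ 0<ε)}} t≤n)

    ^-pos : ∀ {p} n → 0ℚ < p → 0ℚ < p ^ n
    ^-pos zero    0<p = 0<1
    ^-pos (suc n) 0<p = *-pos 0<p (^-pos n 0<p)

    ^-monoˡ-≤ : ∀ {p q} n → 0ℚ < p → p ≤ q → p ^ n ≤ q ^ n
    ^-monoˡ-≤ zero    0<p p≤q = ℚ.≤-refl
    ^-monoˡ-≤ (suc n) 0<p p≤q =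
      *-mono-≤ (ℚ.<⇒≤ 0<p) (ℚ.<⇒≤ (^-pos n (ℚ.<-≤-trans 0<p p≤q))) p≤q
        (^-monoˡ-≤ n 0<p p≤q)

    ^-monoˡ-< : ∀ {p q} n → 0ℚ < p → p < q → p ^ suc n < q ^ suc n
    ^-monoˡ-< {p} {q} n 0<p p<q = ℚ.<-≤-trans
      (ℚ.*-monoˡ-<-pos (p ^ n) {{ℚ.positive (^-pos n 0<p)}} p<q)
      (ℚ.*-monoˡ-≤-nonNeg q {{ℚ.nonNegative (ℚ.<⇒≤ (ℚ.<-trans 0<p p<q))}}
        (^-monoˡ-≤ n 0<p (ℚ.<⇒≤ p<q)))

    ^-cancelˡ-≤ : ∀ {p q} n .{{_ : NonZero n}} → 0ℚ < q → p ^ n ≤ q ^ n → p ≤ q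
    ^-cancelˡ-≤ {p} {q} (suc n) 0<q pⁿ≤qⁿ with p ℚ.≤? q
    ... | yes p≤q = p≤q
    ... | no  p≰q = ⊥-elim (ℚ.<-irrefl refl
          (ℚ.<-≤-trans (^-monoˡ-< n 0<q (ℚ.≰⇒> p≰q)) pⁿ≤qⁿ))

    1≤^ : ∀ {p} n → 1ℚ ≤ p → 1ℚ ≤ p ^ n
    1≤^ zero    1≤p = ℚ.≤-refl
    1≤^ (suc n) 1≤p = *-mono-≤ (ℚ.<⇒≤ 0<1)
      (ℚ.<⇒≤ (^-pos n (ℚ.<-≤-trans 0<1 1≤p))) 1≤p (1≤^ n 1≤p)

  opaque

    bernoulli : ∀ {ε} n → 0ℚ ≤ ε → 1ℚ + n · ε ≤ (1ℚ + ε) ^ n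
    bernoulli zero    0≤ε = ℚ.≤-refl
    bernoulli {ε} (suc n) 0≤ε = ℚ.≤-trans
      (subst (1ℚ + suc n · ε ≤_) (eq ε (n · ε))
        (p≤p+ε (1ℚ + suc n · ε)
          (ℚ.nonNegative⁻¹ (ε * n · ε)
            {{ℚ.nonNeg*nonNeg⇒nonNeg ε {{ℚ.nonNegative 0≤ε}} (n · ε)
              {{ℚ.nonNegative (·-nonNeg n 0≤ε)}}}})))
      (ℚ.*-monoˡ-≤-nonNeg (1ℚ + ε)
        {{ℚ.nonNegative (ℚ.≤-trans 0≤ε (subst (ε ≤_) (ℚ.+-comm ε 1ℚ)
          (p≤p+ε ε (ℚ.<⇒≤ 0<1))))}}
        (bernoulli n 0≤ε))
      where
      open +-*-Solver
      eq : ∀ ε x → 1ℚ + (ε + x) + ε * x ≡ (1ℚ + ε) * (1ℚ + x)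
      eq = solve 2 (λ ε x → con 1ℚ :+ (ε :+ x) :+ ε :* x
                          := (con 1ℚ :+ ε) :* (con 1ℚ :+ x)) refl

  opaque

    ^-unbounded : ∀ p {t} → 1ℚ < t → ∃[ n ] p ≤ t ^ suc n
    ^-unbounded p {t} 1<t with archimedean p (0<q-p 1<t)
    ... | n , p≤nε = n , ℚ.≤-trans p≤nε (ℚ.≤-trans step
          (subst (λ u → 1ℚ + suc n · ε ≤ u ^ suc n) (p+[q-p]≡q 1ℚ t)
            (bernoulli (suc n) 0≤ε)))
      where
      ε : ℚ
      ε = t ℚ.- 1ℚ

      0≤ε : 0ℚ ≤ ε
      0≤ε = ℚ.<⇒≤ (0<q-p 1<t)

      open +-*-Solver
      step : n · ε ≤ 1ℚ + suc n · ε
      step = subst (n · ε ≤_)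
        (solve 2 (λ ε x → x :+ (con 1ℚ :+ ε) := con 1ℚ :+ (ε :+ x)) refl ε (n · ε))
        (p≤p+ε (n · ε) (ℚ.≤-trans (ℚ.<⇒≤ 0<1) (p≤p+ε 1ℚ 0≤ε)))

infixr 8 _^ℤ_

_^ℤ_ : (h : ℕ) .{{_ : NonZero h}} → ℤ → ℚ
h ^ℤ (+ n)    = (+ h ℚ./ 1) ^ n
h ^ℤ -[1+ n ] = (+ 1 ℚ./ h) ^ suc n

private
  module _ (h : ℕ) .{{_ : NonZero h}} where

    toℚᵘ-/ : ∀ i → ℚ.toℚᵘ (i ℚ./ h) ℚᵘ.≃ i ℚᵘ./ h
    toℚᵘ-/ i = lemma h
      where
      lemma : ∀ h .{{_ : NonZero h}} → ℚ.toℚᵘ (i ℚ./ h) ℚᵘ.≃ i ℚᵘ./ h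
      lemma (suc n) = ℚ.toℚᵘ-fromℚᵘ (ℚᵘ.mkℚᵘ i n)

  module Powers (h : ℕ) .{{_ : NonZero h}} where

    h₊ h₋ : ℚ
    h₊ = + h ℚ./ 1
    h₋ = + 1 ℚ./ h

    1≤h₊ : 1ℚ ≤ h₊
    1≤h₊ = ℚ.toℚᵘ-cancel-≤ (ℚᵘ.≤-respʳ-≃ (ℚᵘ.≃-sym (toℚᵘ-/ 1 (+ h)))
      (ℚᵘ.*≤* (ℤ.*-monoʳ-≤-nonNeg (+ 1) (ℤ.+≤+ (ℕ.>-nonZero⁻¹ h)))))

    0<h₋ : 0ℚ < h₋
    0<h₋ = lemma h
      where
      lemma : ∀ h .{{_ : NonZero h}} → 0ℚ < + 1 ℚ./ h
      lemma (suc n) = ℚ.positive⁻¹ _ {{ℚ.normalize-pos 1 (suc n)}}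

    h₊h₋≡1 : h₊ * h₋ ≡ 1ℚ
    h₊h₋≡1 = lemma h
      where
      lemma : ∀ h .{{_ : NonZero h}} → (+ h ℚ./ 1) * (+ 1 ℚ./ h) ≡ 1ℚ
      lemma (suc n) = ℚ.toℚᵘ-injective (ℚᵘ.≃-trans
        (ℚ.toℚᵘ-homo-* (+ suc n ℚ./ 1) (+ 1 ℚ./ suc n))
        (ℚᵘ.≃-trans
          (ℚᵘ.*-cong (toℚᵘ-/ 1 (+ suc n)) (toℚᵘ-/ (suc n) (+ 1)))
          (ℚᵘ.*≡* (eq (+ suc n)))))
        where
        eq : ∀ m → m ℤ.* + 1 ℤ.* + 1 ≡ + 1 ℤ.* (+ 1 ℤ.* m)
        eq = ℤSolver.solve-∀

    0<h₊ : 0ℚ < h₊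
    0<h₊ = ℚ.<-≤-trans 0<1 1≤h₊

    pos : ∀ i → 0ℚ < h ^ℤ i
    pos (+ n)    = ^-pos n 0<h₊
    pos -[1+ n ] = ^-pos (suc n) 0<h₋

    h^-n : ∀ n → h ^ℤ (ℤ.- + n) ≡ h₋ ^ n
    h^-n zero    = refl
    h^-n (suc n) = refl

    h^suc : ∀ i → h ^ℤ (+ 1 ℤ.+ i) ≡ h₊ * h ^ℤ i
    h^suc (+ n)          = refl
    h^suc -[1+ zero ]    = sym (trans (cong (h₊ *_) (ℚ.*-identityʳ h₋)) h₊h₋≡1)
    h^suc -[1+ suc n ]   = sym (trans (sym (ℚ.*-assoc h₊ h₋ (h₋ ^ suc n)))
      (trans (cong (_* h₋ ^ suc n) h₊h₋≡1) (ℚ.*-identityˡ (h₋ ^ suc n))))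

    h^+ : ∀ n i → h ^ℤ (+ n ℤ.+ i) ≡ h₊ ^ n * h ^ℤ i
    h^+ zero    i = trans (cong (h ^ℤ_) (ℤ.+-identityˡ i)) (sym (ℚ.*-identityˡ (h ^ℤ i)))
    h^+ (suc n) i =
      trans (cong (h ^ℤ_) (ℤ.+-assoc (+ 1) (+ n) i))
      (trans (h^suc (+ n ℤ.+ i))
      (trans (cong (h₊ *_) (h^+ n i)) (sym (ℚ.*-assoc h₊ (h₊ ^ n) (h ^ℤ i)))))

    h^* : ∀ i n → h ^ℤ (i ℤ.* + n) ≡ (h ^ℤ i) ^ n
    h^* (+ m) n =
      trans (cong (h ^ℤ_) (sym (ℤ.pos-* m n))) (sym (^-assocʳ h₊ m n))
    h^* -[1+ m ] n = trans (cong (h ^ℤ_) (sym (eq m n)))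
      (trans (h^-n (suc m ℕ.* n)) (sym (^-assocʳ h₋ (suc m) n)))
      where
      eq : ∀ m n → ℤ.- (+ (suc m ℕ.* n)) ≡ -[1+ m ] ℤ.* + n
      eq m n = trans (cong ℤ.-_ (ℤ.pos-* (suc m) n)) (ℤ.neg-distribˡ-* (+ suc m) (+ n))

    h^-mono : ∀ {i j} → i ℤ.≤ j → h ^ℤ i ≤ h ^ℤ j
    h^-mono {i} {j} i≤j = subst₂ _≤_ (ℚ.*-identityˡ (h ^ℤ i))
      (trans (sym (h^+ n i)) (cong (h ^ℤ_) eq))
      (ℚ.*-monoʳ-≤-nonNeg (h ^ℤ i) {{ℚ.nonNegative (ℚ.<⇒≤ (pos i))}} (1≤^ n 1≤h₊))
      where
      n : ℕ
      n = ℤ.∣ j ℤ.- i ∣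

      cancel : ∀ i j → j ℤ.- i ℤ.+ i ≡ j
      cancel = ℤSolver.solve-∀

      eq : + n ℤ.+ i ≡ j
      eq = trans (cong (ℤ._+ i) (ℤ.0≤i⇒+∣i∣≡i (ℤ.i≤j⇒0≤j-i i≤j))) (cancel i j)

-- Two-sided Dedekind cuts.  The witnesses of locatedness are data, so a real
-- number yields rational approximations of any precision.
record ℝ : Set₁ where
  field
    lower upper     : ℚ → Set
    lower-inhabited : ∃ lower
    upper-inhabited : ∃ upper
    lower-closed    : ∀ {p q} → p ℚ.< q → lower q → lower p
    upper-closed    : ∀ {p q} → p ℚ.< q → upper p → upper q
    lower-open      : ∀ {p} → lower p → ∃[ q ] p ℚ.< q × lower q
    upper-open      : ∀ {q} → upper q → ∃[ p ] p ℚ.< q × upper p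
    disjoint        : ∀ {p} → lower p → upper p → ⊥
    located         : ∀ {p q} → p ℚ.< q → lower p ⊎ upper q

open ℝ

infix 4 _<ℝ_ _≤ℝ_ _≃_

_<ℝ_ _≤ℝ_ : ℝ → ℝ → Set
x <ℝ y = ∃[ q ] upper x q × lower y q
x ≤ℝ y = ¬ (y <ℝ x)

-- _≡_ on ℝ is too fine: the two predicates are only meant up to equivalence.
_≃_ : ℝ → ℝ → Set
x ≃ y = x ≤ℝ y × y ≤ℝ x

fromℚ : ℚ → ℝ
fromℚ p = record
  { lower           = _< p
  ; upper           = p <_
  ; lower-inhabited = below p
  ; upper-inhabited = above p
  ; lower-closed    = ℚ.<-trans
  ; upper-closed    = λ q<r p<q → ℚ.<-trans p<q q<r
  ; lower-open      = <-dense
  ; upper-open      = λ p<q → let m , p<m , m<q = <-dense p<q in m , m<q , p<m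
  ; disjoint        = ℚ.<-asym
  ; located         = loc
  }
  where
  loc : ∀ {q r} → q < r → q < p ⊎ p < r
  loc {q} q<r with q ℚ.<? p
  ... | yes q<p = inj₁ q<p
  ... | no  q≮p = inj₂ (ℚ.≤-<-trans (ℚ.≮⇒≥ q≮p) q<r)

0ℝ : ℝ
0ℝ = fromℚ 0ℚ

private

  lower<upper : ∀ x {p q} → lower x p → upper x q → p < q
  lower<upper x {p} {q} p<x x<q with p ℚ.<? q
  ... | yes p<q = p<q
  ... | no  p≮q with ℚ.<-cmp q p
  ...   | tri< q<p _ _ = ⊥-elim (disjoint x p<x (upper-closed x q<p x<q))
  ...   | tri≈ _ refl _ = ⊥-elim (disjoint x p<x x<q)
  ...   | tri> _ _ p<q = p<q

  opaque

    half : ∀ {ε} → 0ℚ < ε → ∃[ δ ] 0ℚ < δ × δ + δ ≡ ε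
    half {ε} 0<ε = ½ * ε , *-pos (ℚ.positive⁻¹ ½) 0<ε ,
      solve 1 (λ ε → con ½ :* ε :+ con ½ :* ε := ε) refl ε
      where open +-*-Solver

  opaque

    approximate : ∀ x {ε} → 0ℚ < ε → ∃₂ λ p q → lower x p × upper x q × q ≤ p + ε
    approximate x {ε} 0<ε with half 0<ε
    ... | δ , 0<δ , δ+δ≡ε with lower-inhabited x | upper-inhabited x
    ...   | p , p<x | q , x<q with archimedean (q ℚ.- p) 0<δ
    ...     | n , q-p≤nδ = search n p<x x<q
          (subst (_≤ p + n · δ) (p+[q-p]≡q p q) (ℚ.+-monoʳ-≤ p q-p≤nδ))
      where
      search : ∀ n {p q} → lower x p → upper x q → q ≤ p + n · δ →
               ∃₂ λ p q → lower x p × upper x q × q ≤ p + ε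
      search zero    {p} {q} p<x x<q q≤p = p , q , p<x , x<q ,
        ℚ.≤-trans q≤p (ℚ.+-monoʳ-≤ p (ℚ.<⇒≤ 0<ε))
      search (suc n) {p} {q} p<x x<q q≤p+nδ with located x (p<p+ε (p + δ) 0<δ)
      ... | inj₁ p+δ<x = search n p+δ<x x<q
            (subst (q ≤_) (sym (ℚ.+-assoc p δ (n · δ))) q≤p+nδ)
      ... | inj₂ x<p+ε = p , _ , p<x , x<p+ε , ℚ.≤-reflexive
            (trans (ℚ.+-assoc p δ δ) (cong (λ e → p + e) δ+δ≡ε))

  opaque

    sum-bound : ∀ {a b c d q m ε} → c ≤ a + ε → d ≤ b + ε → ε + ε ≡ m ℚ.- q →
                a + b ≤ q → c + d ≤ m
    sum-bound {a} {b} {c} {d} {q} {m} {ε} c≤a+ε d≤b+ε ε+ε≡m-q a+b≤q =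
      ℚ.≤-trans (ℚ.+-mono-≤ c≤a+ε d≤b+ε)
        (subst₂ _≤_
          (interchange a b ε ε)
          (trans (cong (λ e → q + e) ε+ε≡m-q) (p+[q-p]≡q q m))
          (ℚ.+-monoˡ-≤ (ε + ε) a+b≤q))

infix  8 -ℝ_
infixl 6 _+ℝ_ _-ℝ_
infixl 7 _*⁺_

_+ℝ_ : ℝ → ℝ → ℝ
x +ℝ y = record
  { lower           = low
  ; upper           = upp
  ; lower-inhabited =
      let a , a<x = lower-inhabited x
          b , b<y = lower-inhabited y
          q , q<a+b = below (a + b)
      in q , a , b , a<x , b<y , q<a+b
  ; upper-inhabited =
      let a , x<a = upper-inhabited x
          b , y<b = upper-inhabited y
          q , a+b<q = above (a + b)
      in q , a , b , x<a , y<b , a+b<q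
  ; lower-closed    = λ { p<q (a , b , a<x , b<y , q<a+b) →
      a , b , a<x , b<y , ℚ.<-trans p<q q<a+b }
  ; upper-closed    = λ { p<q (a , b , x<a , y<b , a+b<p) →
      a , b , x<a , y<b , ℚ.<-trans a+b<p p<q }
  ; lower-open      = λ { (a , b , a<x , b<y , p<a+b) →
      let m , p<m , m<a+b = <-dense p<a+b in m , p<m , a , b , a<x , b<y , m<a+b }
  ; upper-open      = λ { (a , b , x<a , y<b , a+b<q) →
      let m , a+b<m , m<q = <-dense a+b<q in m , m<q , a , b , x<a , y<b , a+b<m }
  ; disjoint        = λ { (a , b , a<x , b<y , q<a+b) (c , d , x<c , y<d , c+d<q) →
      ℚ.<-asym (ℚ.<-trans c+d<q q<a+b)
        (ℚ.+-mono-< (lower<upper x a<x x<c) (lower<upper y b<y y<d)) }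
  ; located         = loc
  }
  where
  low upp : ℚ → Set
  low q = ∃₂ λ a b → lower x a × lower y b × q < a + b
  upp q = ∃₂ λ a b → upper x a × upper y b × a + b < q

  loc : ∀ {q r} → q < r → low q ⊎ upp r
  loc {q} {r} q<r with <-dense q<r
  ... | m , q<m , m<r with half (0<q-p q<m)
  ...   | ε , 0<ε , ε+ε≡m-q with approximate x 0<ε | approximate y 0<ε
  ...     | a , c , a<x , x<c , c≤a+ε | b , d , b<y , y<d , d≤b+ε with q ℚ.<? a + b
  ...       | yes q<a+b = inj₁ (a , b , a<x , b<y , q<a+b)
  ...       | no  q≮a+b = inj₂ (c , d , x<c , y<d ,
                ℚ.≤-<-trans (sum-bound {a} {b} {ε = ε} c≤a+ε d≤b+ε ε+ε≡m-q (ℚ.≮⇒≥ q≮a+b)) m<r)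

private

  -‿<ˡ : ∀ {p q} → p < q → ℚ.- q < ℚ.- p
  -‿<ˡ = ℚ.neg-antimono-<

  neg-involutive : ∀ p → ℚ.- (ℚ.- p) ≡ p
  neg-involutive = solve 1 (λ p → :- (:- p) := p) refl
    where open +-*-Solver

-ℝ_ : ℝ → ℝ
-ℝ x = record
  { lower           = λ q → upper x (ℚ.- q)
  ; upper           = λ q → lower x (ℚ.- q)
  ; lower-inhabited = let q , x<q = upper-inhabited x
                      in ℚ.- q , subst (upper x) (sym (neg-involutive q)) x<q
  ; upper-inhabited = let q , q<x = lower-inhabited x
                      in ℚ.- q , subst (lower x) (sym (neg-involutive q)) q<x
  ; lower-closed    = λ p<q → upper-closed x (-‿<ˡ p<q)
  ; upper-closed    = λ p<q → lower-closed x (-‿<ˡ p<q)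
  ; lower-open      = λ {p} x<-p → let q , q<-p , x<q = upper-open x x<-p
      in ℚ.- q , subst (_< ℚ.- q) (neg-involutive p) (-‿<ˡ q<-p)
       , subst (upper x) (sym (neg-involutive q)) x<q
  ; upper-open      = λ {p} -p<x → let q , -p<q , q<x = lower-open x -p<x
      in ℚ.- q , subst (ℚ.- q <_) (neg-involutive p) (-‿<ˡ -p<q)
       , subst (lower x) (sym (neg-involutive q)) q<x
  ; disjoint        = λ x<-p -p<x → disjoint x -p<x x<-p
  ; located         = loc
  }
  where
  loc : ∀ {p q} → p < q → upper x (ℚ.- p) ⊎ lower x (ℚ.- q)
  loc p<q with located x (-‿<ˡ p<q)
  ... | inj₁ -q<x = inj₂ -q<x
  ... | inj₂ x<-p = inj₁ x<-p

_-ℝ_ : ℝ → ℝ → ℝ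
x -ℝ y = x +ℝ (-ℝ y)

maxℝ : ℝ → ℝ → ℝ
maxℝ x y = record
  { lower           = λ q → lower x q ⊎ lower y q
  ; upper           = λ q → upper x q × upper y q
  ; lower-inhabited = let q , q<x = lower-inhabited x in q , inj₁ q<x
  ; upper-inhabited =
      let p , x<p = upper-inhabited x
          q , y<q = upper-inhabited y
          r , p<r , q<r = aboveBoth p q
      in r , upper-closed x p<r x<p , upper-closed y q<r y<q
  ; lower-closed    = λ { p<q (inj₁ q<x) → inj₁ (lower-closed x p<q q<x)
                        ; p<q (inj₂ q<y) → inj₂ (lower-closed y p<q q<y) }
  ; upper-closed    = λ { p<q (x<p , y<p) → upper-closed x p<q x<p , upper-closed y p<q y<p }
  ; lower-open      = λ { (inj₁ p<x) → let q , p<q , q<x = lower-open x p<x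
                                       in q , p<q , inj₁ q<x
                        ; (inj₂ p<y) → let q , p<q , q<y = lower-open y p<y
                                       in q , p<q , inj₂ q<y }
  ; upper-open      = upp-open
  ; disjoint        = λ { (inj₁ p<x) (x<p , _) → disjoint x p<x x<p
                        ; (inj₂ p<y) (_ , y<p) → disjoint y p<y y<p }
  ; located         = loc
  }
  where
  aboveBoth : ∀ p q → ∃[ r ] p < r × q < r
  aboveBoth p q = p ℚ.⊔ q + 1ℚ
    , ℚ.≤-<-trans (ℚ.p≤p⊔q p q) (p<p+ε (p ℚ.⊔ q) 0<1)
    , ℚ.≤-<-trans (ℚ.p≤q⊔p p q) (p<p+ε (p ℚ.⊔ q) 0<1)

  upp-open : ∀ {q} → upper x q × upper y q → ∃[ p ] p < q × upper x p × upper y p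
  upp-open (x<q , y<q) with upper-open x x<q | upper-open y y<q
  ... | p , p<q , x<p | r , r<q , y<r with ℚ.<-cmp p r
  ...   | tri< p<r _ _ = r , r<q , upper-closed x p<r x<p , y<r
  ...   | tri≈ _ refl _ = p , p<q , x<p , y<r
  ...   | tri> _ _ r<p = p , p<q , x<p , upper-closed y r<p y<r

  loc : ∀ {p q} → p < q → (lower x p ⊎ lower y p) ⊎ (upper x q × upper y q)
  loc p<q with located x p<q | located y p<q
  ... | inj₁ p<x | _        = inj₁ (inj₁ p<x)
  ... | inj₂ _   | inj₁ p<y = inj₁ (inj₂ p<y)
  ... | inj₂ x<q | inj₂ y<q = inj₂ (x<q , y<q)

∣_∣ : ℝ → ℝ
∣ x ∣ = maxℝ x (-ℝ x)

ℝ⁺ : Set₁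
ℝ⁺ = Σ[ x ∈ ℝ ] 0ℝ <ℝ x

private

  opaque

    scale : ∀ {δ K} → 0ℚ < δ → 0ℚ < K → ∃[ ε ] 0ℚ < ε × ε ≤ 1ℚ × ε * K ≤ δ
    scale {δ} {K} 0<δ 0<K with quotient δ K 0<K
    ... | t , tK≡δ with ℚ.≤-total t 1ℚ
    ...   | inj₁ t≤1 = t , 0<t , t≤1 , ℚ.≤-reflexive tK≡δ
      where
      0<t : 0ℚ < t
      0<t = ℚ.*-cancelʳ-<-nonNeg K {{ℚ.nonNegative (ℚ.<⇒≤ 0<K)}}
        (subst₂ _<_ (sym (ℚ.*-zeroˡ K)) (sym tK≡δ) 0<δ)
    ...   | inj₂ 1≤t = 1ℚ , 0<1 , ℚ.≤-refl , subst (1ℚ * K ≤_) tK≡δ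
            (ℚ.*-monoʳ-≤-nonNeg K {{ℚ.nonNegative (ℚ.<⇒≤ 0<K)}} 1≤t)

  opaque

    approximate⁺ : ∀ ((x , _) : ℝ⁺) {ε} → 0ℚ < ε →
                   ∃₂ λ p q → 0ℚ < p × lower x p × upper x q × q ≤ p + ε
    approximate⁺ (x , c , 0<c , c<x) {ε} 0<ε with approximate x 0<ε
    ... | p , q , p<x , x<q , q≤p+ε with ℚ.<-cmp 0ℚ p
    ...   | tri< 0<p _ _ = p , q , 0<p , p<x , x<q , q≤p+ε
    ...   | tri≈ _ refl _ = c , q , 0<c , c<x , x<q ,
            ℚ.≤-trans q≤p+ε (ℚ.+-monoˡ-≤ ε (ℚ.<⇒≤ 0<c))
    ...   | tri> _ _ p<0 = c , q , 0<c , c<x , x<q ,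
            ℚ.≤-trans q≤p+ε (ℚ.+-monoˡ-≤ ε (ℚ.<⇒≤ (ℚ.<-trans p<0 0<c)))

  opaque

    product-bound : ∀ {a b c d q m s t ε} → 0ℚ < c → 0ℚ < b → 0ℚ < ε → ε ≤ 1ℚ →
      a ≤ s → b ≤ t → c ≤ a + ε → d ≤ b + ε → ε * (s + (t + 1ℚ)) ≤ m ℚ.- q →
      a * b ≤ q → c * d ≤ m
    product-bound {a} {b} {c} {d} {q} {m} {s} {t} {ε}
      0<c 0<b 0<ε ε≤1 a≤s b≤t c≤a+ε d≤b+ε εK≤m-q ab≤q =
      ℚ.≤-trans
        (*-mono-≤ (ℚ.<⇒≤ 0<c) (ℚ.<⇒≤ (ℚ.+-mono-< 0<b 0<ε)) c≤a+ε d≤b+ε)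
        (subst₂ _≤_
          (sym expand)
          (p+[q-p]≡q q m)
          (ℚ.+-mono-≤ ab≤q slack))
      where
      expand : (a + ε) * (b + ε) ≡ a * b + ε * (a + (b + ε))
      expand =
        trans (ℚ.*-distribʳ-+ (b + ε) a ε)
        (trans (cong₂ _+_ (ℚ.*-distribˡ-+ a b ε) refl)
        (trans (ℚ.+-assoc (a * b) (a * ε) (ε * (b + ε)))
        (cong (λ e → a * b + e)
          (trans (cong (λ e → e + ε * (b + ε)) (ℚ.*-comm a ε))
            (sym (ℚ.*-distribˡ-+ ε a (b + ε)))))))

      slack : ε * (a + (b + ε)) ≤ m ℚ.- q
      slack = ℚ.≤-trans
        (ℚ.*-monoˡ-≤-nonNeg ε {{ℚ.nonNegative (ℚ.<⇒≤ 0<ε)}}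
          (ℚ.+-mono-≤ a≤s (ℚ.+-mono-≤ b≤t ε≤1)))
        εK≤m-q

_*⁺_ : ℝ⁺ → ℝ⁺ → ℝ⁺
X@(x , u , 0<u , u<x) *⁺ Y@(y , v , 0<v , v<y) = record
  { lower           = low
  ; upper           = upp
  ; lower-inhabited = 0ℚ , u , v , 0<u , 0<v , u<x , v<y , *-pos 0<u 0<v
  ; upper-inhabited =
      let a , x<a = upper-inhabited x
          b , y<b = upper-inhabited y
          q , ab<q = above (a * b)
      in q , a , b , x<a , y<b , ab<q
  ; lower-closed    = λ { p<q (a , b , 0<a , 0<b , a<x , b<y , q<ab) →
      a , b , 0<a , 0<b , a<x , b<y , ℚ.<-trans p<q q<ab }
  ; upper-closed    = λ { p<q (a , b , x<a , y<b , ab<p) →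
      a , b , x<a , y<b , ℚ.<-trans ab<p p<q }
  ; lower-open      = λ { (a , b , 0<a , 0<b , a<x , b<y , p<ab) →
      let m , p<m , m<ab = <-dense p<ab
      in m , p<m , a , b , 0<a , 0<b , a<x , b<y , m<ab }
  ; upper-open      = λ { (a , b , x<a , y<b , ab<q) →
      let m , ab<m , m<q = <-dense ab<q in m , m<q , a , b , x<a , y<b , ab<m }
  ; disjoint        = λ { (a , b , 0<a , 0<b , a<x , b<y , q<ab) (c , d , x<c , y<d , cd<q) →
      ℚ.<-asym (ℚ.<-trans cd<q q<ab)
        (*-mono-< 0<a (ℚ.<-trans 0<b (lower<upper y b<y y<d))
          (lower<upper x a<x x<c) (lower<upper y b<y y<d)) }
  ; located         = loc
  } , positive
  where
  low upp : ℚ → Set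
  low q = ∃₂ λ a b → 0ℚ < a × 0ℚ < b × lower x a × lower y b × q < a * b
  upp q = ∃₂ λ a b → upper x a × upper y b × a * b < q

  positive : ∃[ q ] 0ℚ < q × low q
  positive with <-dense (*-pos 0<u 0<v)
  ... | m , 0<m , m<uv = m , 0<m , u , v , 0<u , 0<v , u<x , v<y , m<uv

  loc : ∀ {q r} → q < r → low q ⊎ upp r
  loc {q} {r} q<r with <-dense q<r | upper-inhabited x | upper-inhabited y
  ... | m , q<m , m<r | s , x<s | t , y<t
      with scale {K = s + (t + 1ℚ)} (0<q-p q<m)
             (ℚ.+-mono-< (ℚ.<-trans 0<u (lower<upper x u<x x<s))
               (ℚ.+-mono-< (ℚ.<-trans 0<v (lower<upper y v<y y<t)) 0<1))
  ...   | ε , 0<ε , ε≤1 , εK≤m-q with approximate⁺ X 0<ε | approximate⁺ Y 0<ε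
  ...     | a , c , 0<a , a<x , x<c , c≤a+ε | b , d , 0<b , b<y , y<d , d≤b+ε
          with q ℚ.<? a * b
  ...       | yes q<ab = inj₁ (a , b , 0<a , 0<b , a<x , b<y , q<ab)
  ...       | no  q≮ab = inj₂ (c , d , x<c , y<d , ℚ.≤-<-trans
                (product-bound {a} {b} {s = s} {t} {ε} (ℚ.<-trans 0<a (lower<upper x a<x x<c)) 0<b 0<ε ε≤1
                  (ℚ.<⇒≤ (lower<upper x a<x x<s)) (ℚ.<⇒≤ (lower<upper y b<y y<t))
                  c≤a+ε d≤b+ε εK≤m-q (ℚ.≮⇒≥ q≮ab))
                m<r)

private

  module RealPower (h : ℕ) .{{_ : NonZero h}} (x : ℝ) where

    open Powers h

    low upp : ℚ → Set
    low q = ∃₂ λ r s → lower x r × 0ℚ < s × s ^ ↧ₙ r ≤ h ^ℤ ↥ r × q < s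
    upp q = ∃₂ λ r s → upper x r × 0ℚ < s × h ^ℤ ↥ r ≤ s ^ ↧ₙ r × s < q

    private
      root : ∀ {s} m → 0ℚ < s → s ≤ 1ℚ → s ^ suc m ≤ s
      root {s} m 0<s s≤1 = subst (s ^ suc m ≤_) (ℚ.*-identityʳ s)
        (ℚ.*-monoˡ-≤-nonNeg s {{ℚ.nonNegative (ℚ.<⇒≤ 0<s)}} (^≤1 m))
        where
        ^≤1 : ∀ m → s ^ m ≤ 1ℚ
        ^≤1 zero    = ℚ.≤-refl
        ^≤1 (suc m) = ℚ.≤-trans
          (ℚ.*-monoˡ-≤-nonNeg s {{ℚ.nonNegative (ℚ.<⇒≤ 0<s)}} (^≤1 m))
          (subst (_≤ 1ℚ) (sym (ℚ.*-identityʳ s)) s≤1)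

    opaque

      underroot : ∀ i b .{{_ : NonZero b}} → ∃[ s ] 0ℚ < s × s ^ b ≤ h ^ℤ i
      underroot i (suc b) with ℚ.≤-total (h ^ℤ i) 1ℚ
      ... | inj₁ hⁱ≤1 = h ^ℤ i , pos i , root b (pos i) hⁱ≤1
      ... | inj₂ 1≤hⁱ = 1ℚ , 0<1 , ℚ.≤-trans (root b 0<1 ℚ.≤-refl) 1≤hⁱ

      overroot : ∀ i b .{{_ : NonZero b}} → ∃[ s ] 0ℚ < s × h ^ℤ i ≤ s ^ b
      overroot i (suc b) with ℚ.≤-total (h ^ℤ i) 1ℚ
      ... | inj₁ hⁱ≤1 = 1ℚ , 0<1 , ℚ.≤-trans hⁱ≤1 (1≤^ (suc b) ℚ.≤-refl)
      ... | inj₂ 1≤hⁱ = h ^ℤ i , pos i , subst (_≤ (h ^ℤ i) ^ suc b) (ℚ.*-identityʳ (h ^ℤ i))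
            (ℚ.*-monoˡ-≤-nonNeg (h ^ℤ i) {{ℚ.nonNegative (ℚ.<⇒≤ (pos i))}} (1≤^ b 1≤hⁱ))

    opaque

      low-inhabited⁺ : ∃[ q ] 0ℚ < q × low q
      low-inhabited⁺ with lower-inhabited x
      ... | r , r<x with underroot (↥ r) (↧ₙ r)
      ...   | s , 0<s , sᵇ≤hᵃ with <-dense 0<s
      ...     | q , 0<q , q<s = q , 0<q , r , s , r<x , 0<s , sᵇ≤hᵃ , q<s

      upp-inhabited : ∃ upp
      upp-inhabited with upper-inhabited x
      ... | r , x<r with overroot (↥ r) (↧ₙ r)
      ...   | s , 0<s , hᵃ≤sᵇ with above s
      ...     | q , s<q = q , r , s , x<r , 0<s , hᵃ≤sᵇ , s<q

      low-upp-disjoint : ∀ {q} → low q → upp q → ⊥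
      low-upp-disjoint
        (r@(mkℚ a b-1 _) , s , r<x , 0<s , sᵇ≤hᵃ , q<s)
        (t@(mkℚ c d-1 _) , u , x<t , 0<u , hᶜ≤uᵈ , u<q) =
        ℚ.<-irrefl refl (ℚ.<-≤-trans (ℚ.<-trans u<q q<s) s≤u)
        where
        b d : ℕ
        b = suc b-1
        d = suc d-1

        ad≤cb : a ℤ.* + d ℤ.≤ c ℤ.* + b
        ad≤cb = ℤ.<⇒≤ (ℚ.drop-*<* (lower<upper x r<x x<t))

        s≤u : s ≤ u
        s≤u = ^-cancelˡ-≤ (b ℕ.* d) 0<u
          (subst₂ _≤_ (^-assocʳ s b d)
            (trans (^-assocʳ u d b) (cong (u ^_) (ℕ.*-comm d b)))
            (ℚ.≤-trans (^-monoˡ-≤ d (^-pos b 0<s) sᵇ≤hᵃ)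
            (ℚ.≤-trans (subst₂ _≤_ (h^* a d) (h^* c b) (h^-mono ad≤cb))
              (^-monoˡ-≤ b (pos c) hᶜ≤uᵈ))))

      -- If h^(a/b) ≤ m, h ≤ t^n and c/d ≤ a/b + 1/n, then h^(c/d) ≤ m t.
      stretch : ∀ r u {m t} n .{{_ : NonZero n}} → 0ℚ < m → 0ℚ < t →
        u ≤ r + (+ 1 ℚ./ n) → h₊ ≤ t ^ n → h ^ℤ ↥ r ≤ m ^ ↧ₙ r →
        h ^ℤ ↥ u ≤ (m * t) ^ ↧ₙ u
      stretch r@(mkℚ a b-1 _) u@(mkℚ c d-1 _) {m} {t} n@(suc n-1) 0<m 0<t u≤r+1/n h≤tⁿ hᵃ≤mᵇ =
        ^-cancelˡ-≤ (b ℕ.* n) (^-pos d (*-pos 0<m 0<t))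
          (subst₂ _≤_ (h^* c (b ℕ.* n)) eq
            (ℚ.≤-trans (h^-mono bound)
              (subst (_≤ ((m ^ b) ^ n * (t ^ n) ^ b) ^ d)
                (sym (trans (h^* (+ b ℤ.+ a ℤ.* + n) d)
                  (cong (_^ d) (trans (h^+ b (a ℤ.* + n))
                    (trans (ℚ.*-comm (h₊ ^ b) (h ^ℤ (a ℤ.* + n)))
                      (cong (_* h₊ ^ b) (h^* a n)))))))
                (^-monoˡ-≤ d (*-pos (^-pos n (pos a)) (^-pos b 0<h₊))
                  (*-mono-≤ (ℚ.<⇒≤ (^-pos n (pos a))) (ℚ.<⇒≤ (^-pos b (^-pos n 0<t)))
                    (^-monoˡ-≤ n (pos a) hᵃ≤mᵇ) (^-monoˡ-≤ b 0<h₊ h≤tⁿ))))))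
        where
        b d : ℕ
        b = suc b-1
        d = suc d-1

        bound : c ℤ.* + (b ℕ.* n) ℤ.≤ (+ b ℤ.+ a ℤ.* + n) ℤ.* + d
        bound = subst (λ i → c ℤ.* + (b ℕ.* n) ℤ.≤ i ℤ.* + d)
          (trans (cong (λ i → a ℤ.* + n ℤ.+ i) (ℤ.*-identityˡ (+ b))) (ℤ.+-comm (a ℤ.* + n) (+ b)))
          (ℚᵘ.drop-*≤* (ℚᵘ.≤-respʳ-≃
            (ℚᵘ.≃-trans (ℚ.toℚᵘ-homo-+ r (+ 1 ℚ./ n))
              (ℚᵘ.+-congʳ (ℚ.toℚᵘ r) (toℚᵘ-/ n (+ 1))))
            (ℚ.toℚᵘ-mono-≤ u≤r+1/n)))

        eq : ((m ^ b) ^ n * (t ^ n) ^ b) ^ d ≡ ((m * t) ^ d) ^ (b ℕ.* n)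
        eq =
          trans (cong (_^ d) (trans
            (cong₂ _*_ (^-assocʳ m b n)
              (trans (^-assocʳ t n b) (cong (t ^_) (ℕ.*-comm n b))))
            (sym (^-distrib-* m t (b ℕ.* n)))))
          (trans (^-assocʳ (m * t) (b ℕ.* n) d)
          (trans (cong ((m * t) ^_) (ℕ.*-comm (b ℕ.* n) d))
            (sym (^-assocʳ (m * t) d (b ℕ.* n)))))

    opaque

      0<1/ : ∀ n → 0ℚ < + 1 ℚ./ suc n
      0<1/ n = ℚ.positive⁻¹ _ {{ℚ.normalize-pos 1 (suc n)}}

      low⊎upp⁺ : ∀ {q m v w} → 0ℚ < m → q < m → m < v → v < w → low q ⊎ upp w
      low⊎upp⁺ {q} {m} {v} {w} 0<m q<m m<v v<w with quotient v m 0<m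
      ... | t , tm≡v with ℚ.*-cancelʳ-<-nonNeg m {{ℚ.nonNegative (ℚ.<⇒≤ 0<m)}}
                            (subst₂ _<_ (sym (ℚ.*-identityˡ m)) (sym tm≡v) m<v)
      ...   | 1<t with ^-unbounded h₊ 1<t
      ...     | n , h≤tⁿ with approximate x (0<1/ n)
      ...       | r , u , r<x , x<u , u≤r+1/n with m ^ ↧ₙ r ℚ.≤? h ^ℤ ↥ r
      ...         | yes mᵇ≤hᵃ = inj₁ (r , m , r<x , 0<m , mᵇ≤hᵃ , q<m)
      ...         | no  mᵇ≰hᵃ = inj₂ (u , v , x<u , ℚ.<-trans 0<m m<v ,
                    subst (λ e → h ^ℤ ↥ u ≤ e ^ ↧ₙ u) (trans (ℚ.*-comm m t) tm≡v)
                      (stretch r u (suc n) 0<m (ℚ.<-trans 0<1 1<t) u≤r+1/n h≤tⁿ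
                        (ℚ.<⇒≤ (ℚ.≰⇒> mᵇ≰hᵃ))) ,
                    v<w)

      low⊎upp : ∀ {q w} → q < w → low q ⊎ upp w
      low⊎upp {q} {w} q<w with 0ℚ ℚ.≤? q
      ... | no 0≰q with lower-inhabited x
      ...   | r , r<x with underroot (↥ r) (↧ₙ r)
      ...     | s , 0<s , sᵇ≤hᵃ =
                inj₁ (r , s , r<x , 0<s , sᵇ≤hᵃ , ℚ.<-trans (ℚ.≰⇒> 0≰q) 0<s)
      low⊎upp {q} {w} q<w | yes 0≤q with <-dense q<w
      ... | m , q<m , m<w with <-dense m<w
      ...   | v , m<v , v<w = low⊎upp⁺ (ℚ.≤-<-trans 0≤q q<m) q<m m<v v<w

infixr 8 _^ℝ_

-- The real power h^x of an integer h ≥ 1: for h > 1 it is characterised by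
-- h^r < h^x < h^t for rational r < x < t, and for s > 0 the inequality
-- s ≤ h^(a/b) means s^b ≤ h^a.
_^ℝ_ : (h : ℕ) .{{_ : NonZero h}} → ℝ → ℝ
h ^ℝ x = record
  { lower           = λ q → ∃₂ λ r s → lower x r × 0ℚ ℚ.< s × s ^ ↧ₙ r ℚ.≤ h ^ℤ ↥ r × q ℚ.< s
  ; upper           = λ q → ∃₂ λ r s → upper x r × 0ℚ ℚ.< s × h ^ℤ ↥ r ℚ.≤ s ^ ↧ₙ r × s ℚ.< q
  ; lower-inhabited = let q , _ , q∈low = low-inhabited⁺ in q , q∈low
  ; upper-inhabited = upp-inhabited
  ; lower-closed    = λ { p<q (r , s , r<x , 0<s , sᵇ≤hᵃ , q<s) →
      r , s , r<x , 0<s , sᵇ≤hᵃ , ℚ.<-trans p<q q<s }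
  ; upper-closed    = λ { p<q (r , s , x<r , 0<s , hᵃ≤sᵇ , s<p) →
      r , s , x<r , 0<s , hᵃ≤sᵇ , ℚ.<-trans s<p p<q }
  ; lower-open      = λ { (r , s , r<x , 0<s , sᵇ≤hᵃ , p<s) →
      let m , p<m , m<s = <-dense p<s in m , p<m , r , s , r<x , 0<s , sᵇ≤hᵃ , m<s }
  ; upper-open      = λ { (r , s , x<r , 0<s , hᵃ≤sᵇ , s<q) →
      let m , s<m , m<q = <-dense s<q in m , m<q , r , s , x<r , 0<s , hᵃ≤sᵇ , s<m }
  ; disjoint        = low-upp-disjoint
  ; located         = low⊎upp
  }
  where open RealPower h x

height : ℚ → ℕ
height r = ℤ.∣ ↥ r ∣ ℕ.⊔ ↧ₙ r

height-nonZero : ∀ r → NonZero (height r)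
height-nonZero r =
  ℕ.>-nonZero (ℕ.<-≤-trans (ℕ.>-nonZero⁻¹ (↧ₙ r)) (ℕ.m≤n⊔m ℤ.∣ ↥ r ∣ (↧ₙ r)))

heightPower : ℚ → ℝ → ℝ
heightPower r x = height r ^ℝ x
  where instance _ = height-nonZero r

-- a₀ + 1/(a₁ + 1/(a₂ + ⋯)), infinite, with aₖ ≥ 1 for k ≥ 1;
-- a₁₊ k is aₖ₊₁.
record ContinuedFraction : Set where
  field
    a₀          : ℤ
    a₁₊         : ℕ → ℕ
    a₁₊-nonZero : ∀ k → NonZero (a₁₊ k)

  numerator : ℕ → ℤ
  numerator 0             = a₀
  numerator 1             = + a₁₊ 0 ℤ.* a₀ ℤ.+ + 1
  numerator (suc (suc k)) =
    + a₁₊ (suc k) ℤ.* numerator (suc k) ℤ.+ numerator k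

  denominator : ℕ → ℕ
  denominator 0             = 1
  denominator 1             = a₁₊ 0
  denominator (suc (suc k)) =
    a₁₊ (suc k) ℕ.* denominator (suc k) ℕ.+ denominator k

  denominator-nonZero : ∀ k → NonZero (denominator k)
  denominator-nonZero 0             = _
  denominator-nonZero 1             = a₁₊-nonZero 0
  denominator-nonZero (suc (suc k)) =
    ℕ.>-nonZero (ℕ.<-≤-trans (ℕ.>-nonZero⁻¹ (denominator k) {{denominator-nonZero k}})
      (ℕ.m≤n+m (denominator k) (a₁₊ (suc k) ℕ.* denominator (suc k))))

  convergent : ℕ → ℚ
  convergent k = numerator k ℚ./ denominator k
    where instance _ = denominator-nonZero k

ConvergesTo : (ℕ → ℝ) → ℝ → Set₁
ConvergesTo x l =
  ∀ ((ε , _) : ℝ⁺) → ∃[ N ] ∀ n → n ℕ.≥ N → ∣ x n -ℝ l ∣ <ℝ ε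

TendsToInfinity : (ℕ → ℝ) → Set₁
TendsToInfinity x = ∀ M → ∃[ N ] ∀ n → n ℕ.≥ N → M <ℝ x n

Irrational : Pred ℝ _
Irrational ξ = ∀ r → ¬ (ξ ≃ fromℚ r)

-- For irrational ξ this holds of exactly one c.
_IsExpansionOf_ : ContinuedFraction → ℝ → Set₁
c IsExpansionOf ξ = ConvergesTo (fromℚ ∘ convergent) ξ
  where open ContinuedFraction c

StrongLiouville : Pred ℝ _
StrongLiouville ξ = Irrational ξ ×
  Σ[ c ∈ ContinuedFraction ] c IsExpansionOf ξ ×
    (let q = ContinuedFraction.denominator c in
     ∀ n → n ℕ.≥ 1 → ∃[ N ] ∀ k → k ℕ.> N → q (suc k) ℕ.> q k ℕ.^ n)

InfinitelyManyValues : (ℕ → ℚ) → Set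
InfinitelyManyValues r = ∀ (rs : List ℚ) → ∃[ n ] r n ∉ rs

-- The sequences ω and r are indexed from 0 instead of 1.
𝓛 : Pred ℝ _
𝓛 ξ =
  Σ[ ω ∈ (ℕ → ℝ⁺) ] Σ[ r ∈ (ℕ → ℚ) ] Σ[ C ∈ ℝ⁺ ]
    TendsToInfinity (proj₁ ∘ ω)
  × InfinitelyManyValues r
  × (∀ n → ∣ ξ -ℝ fromℚ (r n) ∣ <ℝ heightPower (r n) (-ℝ proj₁ (ω n)))
  × (∀ n → fromℚ (+ height (r (suc n)) ℚ./ 1) ≤ℝ heightPower (r n) (proj₁ (C *⁺ ω n)))

-- A set of reals is countable when some sequence lists all its elements;
-- the sequence may also list other reals, so the empty set is countable.
Countable : ∀ {ℓ} → Pred ℝ ℓ → Set _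
Countable S = Σ[ f ∈ (ℕ → ℝ) ] ∀ {ξ} → ξ ∈ S → ∃[ n ] ξ ≃ f n

Uncountable : ∀ {ℓ} → Pred ℝ ℓ → Set _
Uncountable S = ¬ Countable S

{-# OPTIONS --safe #-}

-- If p/q and p'/q' are consecutive convergents of ξ then |ξ − p/q| ≤ 1/(q q'),
-- and H(p/q) is at most a constant times q.  For a strong Liouville number the
-- convergents from some index on, with ω the integer such that
-- H^(ω+1) ≤ q' < H^(ω+2), therefore witness membership in 𝓛 with C = 4.
--
-- Given a sequence f of reals, build ξ as a limit of fractions Pₙ/Dₙ,
-- where Pₙ₊₁/Dₙ₊₁ = Rₙ/Fₙ + (1+c)/Dₙ₊₁, Rₙ/Fₙ = Pₙ/Dₙ + 1/Fₙ, Fₙ = Dₙ⁴,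
-- Dₙ₊₁ = Fₙ^(4+n), and c ∈ {0, Dₙ} is chosen so that ξ differs from f n.  The
-- fractions Rₙ/Fₙ approximate ξ with exponent about 4 + n, which puts ξ in 𝓛.
-- But Pₙ/Dₙ approximates ξ with exponent only 4, which is still enough to
-- make it a convergent; its successor has denominator at most Dₙ³, so ξ is
-- not strong.

module Submission where

open import Defs
open import Data.Product.Base using (_×_)
open import Relation.Unary using (_⊆_; _∖_)

open import Algebra.Definitions.RawSemiring using () renaming (_^_ to pow)
open import Algebra.Properties.CommutativeSemigroup using (x∙yz≈y∙xz)
open import Data.Empty using (⊥; ⊥-elim)
open import Data.Integer.Base as ℤ using (ℤ; +_; -[1+_])
import Data.Integer.Divisibility.Signed as ℤ
import Data.Integer.GCD as ℤ
import Data.Integer.Properties as ℤ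
import Data.Integer.Tactic.RingSolver as ℤSolver
open import Data.List.Base using (List; []; _∷_)
open import Data.List.Membership.Propositional using (_∉_)
open import Data.List.Relation.Unary.Any using (here; there)
open import Data.Nat.Base as ℕ using (ℕ; zero; suc; NonZero)
open import Data.Nat.Coprimality as ℕ using (Coprime; 1-coprimeTo)
import Data.Nat.Divisibility as ℕ
import Data.Nat.Properties as ℕ
import Data.Nat.Tactic.RingSolver as ℕSolver
open import Data.Product.Base using (∃-syntax; _,_; proj₁; proj₂)
open import Data.Rational.Base as ℚ using (ℚ; mkℚ; 0ℚ; 1ℚ; ↥_; ↧_; ↧ₙ_)
import Data.Rational.Properties as ℚ
open import Data.Rational.Solver using (module +-*-Solver)
import Data.Rational.Unnormalised.Base as ℚᵘ
import Data.Rational.Unnormalised.Properties as ℚᵘ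
open import Data.Sum.Base using (_⊎_; inj₁; inj₂; map; [_,_]′)
open import Function.Base using (_∘_)
open import Relation.Binary.PropositionalEquality
open import Relation.Nullary.Decidable.Core using (yes; no)
open import Relation.Nullary.Negation.Core using (¬_)

open ℝ

-- Fractions

infixr 8 _^ℚ_
_^ℚ_ : ℚ → ℕ → ℚ
_^ℚ_ = pow ℚ.+-*-rawSemiring

<⇒≱ : ∀ {p q} → p ℚ.< q → ¬ q ℚ.≤ p
<⇒≱ p<q q≤p = ℚ.<-irrefl refl (ℚ.<-≤-trans p<q q≤p)

<⊎≥ : ∀ p q → p ℚ.< q ⊎ q ℚ.≤ p
<⊎≥ p q with p ℚ.<? q
... | yes p<q = inj₁ p<q
... | no  p≮q = inj₂ (ℚ.≮⇒≥ p≮q)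

toℚᵘ-/ : ∀ i n .{{_ : NonZero n}} → ℚ.toℚᵘ (i ℚ./ n) ℚᵘ.≃ i ℚᵘ./ n
toℚᵘ-/ i (suc n) = ℚ.toℚᵘ-fromℚᵘ (ℚᵘ.mkℚᵘ i n)

/-mono-≤ : ∀ i j m n .{{_ : NonZero m}} .{{_ : NonZero n}} →
           i ℤ.* + n ℤ.≤ j ℤ.* + m → i ℚ./ m ℚ.≤ j ℚ./ n
/-mono-≤ i j m@(suc _) n@(suc _) le = ℚ.toℚᵘ-cancel-≤
  (ℚᵘ.≤-respˡ-≃ (ℚᵘ.≃-sym (toℚᵘ-/ i m)) (ℚᵘ.≤-respʳ-≃ (ℚᵘ.≃-sym (toℚᵘ-/ j n)) (ℚᵘ.*≤* le)))

/-cancel-≤ : ∀ i j m n .{{_ : NonZero m}} .{{_ : NonZero n}} →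
             i ℚ./ m ℚ.≤ j ℚ./ n → i ℤ.* + n ℤ.≤ j ℤ.* + m
/-cancel-≤ i j m@(suc _) n@(suc _) le = ℚᵘ.drop-*≤*
  (ℚᵘ.≤-respˡ-≃ (toℚᵘ-/ i m) (ℚᵘ.≤-respʳ-≃ (toℚᵘ-/ j n) (ℚ.toℚᵘ-mono-≤ le)))

/-mono-< : ∀ i j m n .{{_ : NonZero m}} .{{_ : NonZero n}} →
           i ℤ.* + n ℤ.< j ℤ.* + m → i ℚ./ m ℚ.< j ℚ./ n
/-mono-< i j m n in<jm = ℚ.≰⇒> (λ j/n≤i/m → ℤ.<⇒≱ in<jm (/-cancel-≤ j i n m j/n≤i/m))

frac-≤ : ∀ a b m n .{{_ : NonZero m}} .{{_ : NonZero n}} →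
         a ℕ.* n ℕ.≤ b ℕ.* m → + a ℚ./ m ℚ.≤ + b ℚ./ n
frac-≤ a b m n an≤bm = /-mono-≤ (+ a) (+ b) m n
  (subst₂ ℤ._≤_ (ℤ.pos-* a n) (ℤ.pos-* b m) (ℤ.+≤+ an≤bm))

frac-< : ∀ a b m n .{{_ : NonZero m}} .{{_ : NonZero n}} →
         a ℕ.* n ℕ.< b ℕ.* m → + a ℚ./ m ℚ.< + b ℚ./ n
frac-< a b m n an<bm = /-mono-< (+ a) (+ b) m n
  (subst₂ ℤ._<_ (ℤ.pos-* a n) (ℤ.pos-* b m) (ℤ.+<+ an<bm))

/-≡ : ∀ i j m n .{{_ : NonZero m}} .{{_ : NonZero n}} →
      i ℤ.* + n ≡ j ℤ.* + m → i ℚ./ m ≡ j ℚ./ n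
/-≡ i j m n eq = ℚ.≤-antisym (/-mono-≤ i j m n (ℤ.≤-reflexive eq))
                             (/-mono-≤ j i n m (ℤ.≤-reflexive (sym eq)))

/-+ : ∀ i j m n .{{_ : NonZero m}} .{{_ : NonZero n}} .{{_ : NonZero (m ℕ.* n)}} →
      i ℚ./ m ℚ.+ j ℚ./ n ≡ (i ℤ.* + n ℤ.+ j ℤ.* + m) ℚ./ (m ℕ.* n)
/-+ i j m@(suc _) n@(suc _) = ℚ.toℚᵘ-injective
  (ℚᵘ.≃-trans (ℚ.toℚᵘ-homo-+ (i ℚ./ m) (j ℚ./ n))
  (ℚᵘ.≃-trans (ℚᵘ.+-cong (toℚᵘ-/ i m) (toℚᵘ-/ j n))
  (ℚᵘ.≃-sym (toℚᵘ-/ (i ℤ.* + n ℤ.+ j ℤ.* + m) (m ℕ.* n)))))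

/-* : ∀ i j m n .{{_ : NonZero m}} .{{_ : NonZero n}} .{{_ : NonZero (m ℕ.* n)}} →
      (i ℚ./ m) ℚ.* (j ℚ./ n) ≡ (i ℤ.* j) ℚ./ (m ℕ.* n)
/-* i j m@(suc _) n@(suc _) = ℚ.toℚᵘ-injective
  (ℚᵘ.≃-trans (ℚ.toℚᵘ-homo-* (i ℚ./ m) (j ℚ./ n))
  (ℚᵘ.≃-trans (ℚᵘ.*-cong (toℚᵘ-/ i m) (toℚᵘ-/ j n))
  (ℚᵘ.≃-sym (toℚᵘ-/ (i ℤ.* j) (m ℕ.* n)))))

/-+-same : ∀ i j n .{{_ : NonZero n}} → i ℚ./ n ℚ.+ j ℚ./ n ≡ (i ℤ.+ j) ℚ./ n
/-+-same i j n = trans (/-+ i j n n) (/-≡ (i ℤ.* + n ℤ.+ j ℤ.* + n) (i ℤ.+ j) (n ℕ.* n) n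
  (eq (+ n) (ℤ.pos-* n n)))
  where
  instance
    _ = ℕ.m*n≢0 n n
  solve : ∀ i j n → (i ℤ.* n ℤ.+ j ℤ.* n) ℤ.* n ≡ (i ℤ.+ j) ℤ.* (n ℤ.* n)
  solve = ℤSolver.solve-∀
  -- The cast of a product is generalised, leaving an identity for the ring solver.
  eq : ∀ n {n²} → n² ≡ n ℤ.* n → (i ℤ.* n ℤ.+ j ℤ.* n) ℤ.* n ≡ (i ℤ.+ j) ℤ.* n²
  eq n refl = solve i j n

/-expand : ∀ i m t .{{_ : NonZero m}} .{{_ : NonZero (m ℕ.* t)}} →
           (i ℤ.* + t) ℚ./ (m ℕ.* t) ≡ i ℚ./ m
/-expand i m t = /-≡ (i ℤ.* + t) i (m ℕ.* t) m (eq (+ m) (+ t) (ℤ.pos-* m t))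
  where
  solve : ∀ i m t → i ℤ.* t ℤ.* m ≡ i ℤ.* (m ℤ.* t)
  solve = ℤSolver.solve-∀
  eq : ∀ m t {mt} → mt ≡ m ℤ.* t → i ℤ.* t ℤ.* m ≡ i ℤ.* mt
  eq m t refl = solve i m t

1/^ : ∀ h n .{{_ : NonZero h}} .{{_ : NonZero (h ℕ.^ n)}} → (+ 1 ℚ./ h) ^ℚ n ≡ + 1 ℚ./ h ℕ.^ n
1/^ h zero    = refl
1/^ h (suc n) = trans (cong ((+ 1 ℚ./ h) ℚ.*_) (1/^ h n)) (/-* (+ 1) (+ 1) h (h ℕ.^ n))
  where instance _ = ℕ.m^n≢0 h n

i≤∣i∣ : ∀ i → i ℤ.≤ + ℤ.∣ i ∣
i≤∣i∣ (+ n)    = ℤ.≤-refl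
i≤∣i∣ -[1+ n ] = ℤ.-≤+

-- Opaque because unification would otherwise unfold the gcd inside _/_.
opaque

  ι : ℕ → ℚ
  ι n = + n ℚ./ 1

  ι≡/ : ∀ n → ι n ≡ + n ℚ./ 1
  ι≡/ n = refl

  ι≡mkℚ : ∀ n → ι n ≡ mkℚ (+ n) 0 (ℕ.sym (1-coprimeTo n))
  ι≡mkℚ n = ℚ.normalize-coprime (ℕ.sym (1-coprimeTo n))

  ι-* : ∀ m n → ι m ℚ.* ι n ≡ ι (m ℕ.* n)
  ι-* m n = trans (/-* (+ m) (+ n) 1 1) (cong (ℚ._/ 1) (sym (ℤ.pos-* m n)))

  ι-^ : ∀ m n → ι m ^ℚ n ≡ ι (m ℕ.^ n)
  ι-^ m zero    = refl
  ι-^ m (suc n) = trans (cong (ι m ℚ.*_) (ι-^ m n)) (ι-* m (m ℕ.^ n))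

  ι-mono-≤ : ∀ {m n} → m ℕ.≤ n → ι m ℚ.≤ ι n
  ι-mono-≤ {m} {n} m≤n = /-mono-≤ (+ m) (+ n) 1 1 (ℤ.*-monoʳ-≤-nonNeg (+ 1) (ℤ.+≤+ m≤n))

  ι-mono-< : ∀ {m n} → m ℕ.< n → ι m ℚ.< ι n
  ι-mono-< {m} {n} m<n = /-mono-< (+ m) (+ n) 1 1 (ℤ.*-monoʳ-<-pos (+ 1) (ℤ.+<+ m<n))

  0<ι : ∀ {n} → 0 ℕ.< n → 0ℚ ℚ.< ι n
  0<ι {n} 0<n = ι-mono-< {0} {n} 0<n

  0≤ι : ∀ n → 0ℚ ℚ.≤ ι n
  0≤ι n = ι-mono-≤ {0} {n} ℕ.z≤n

  ι≤⇒ : ∀ m r → ι m ℚ.≤ r → + m ℤ.* ↧ r ℤ.≤ ↥ r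
  ι≤⇒ m r le = subst (+ m ℤ.* ↧ r ℤ.≤_) (ℤ.*-identityʳ (↥ r))
    (/-cancel-≤ (+ m) (↥ r) 1 (↧ₙ r) (subst (ι m ℚ.≤_) (sym (ℚ.↥p/↧p≡p r)) le))

  archimedean : ∀ p → ∃[ n ] p ℚ.< ι n
  archimedean p@(mkℚ i d _) = suc ℤ.∣ i ∣ ,
    subst (ℚ._< ι (suc ℤ.∣ i ∣)) (ℚ.↥p/↧p≡p p)
      (/-mono-< i (+ suc ℤ.∣ i ∣) (suc d) 1 (ℤ.≤-<-trans
        (subst (ℤ._≤ + ℤ.∣ i ∣) (sym (ℤ.*-identityʳ i)) (i≤∣i∣ i))
        (subst (+ ℤ.∣ i ∣ ℤ.<_) (ℤ.pos-* (suc ℤ.∣ i ∣) (suc d))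
          (ℤ.+<+ (ℕ.m≤m*n (suc ℤ.∣ i ∣) (suc d))))))

^ℚ-pos : ∀ {p} n → 0ℚ ℚ.< p → 0ℚ ℚ.< p ^ℚ n
^ℚ-pos     zero    0<p = ℚ.positive⁻¹ 1ℚ
^ℚ-pos {p} (suc n) 0<p = ℚ.positive⁻¹ (p ℚ.* p ^ℚ n)
  {{ℚ.pos*pos⇒pos p {{ℚ.positive 0<p}} (p ^ℚ n) {{ℚ.positive (^ℚ-pos n 0<p)}}}}

^ℚ-mono-< : ∀ {p q} n → 0ℚ ℚ.< p → p ℚ.< q → p ^ℚ suc n ℚ.< q ^ℚ suc n
^ℚ-mono-< {p} {q} zero 0<p p<q =
  subst₂ ℚ._<_ (sym (ℚ.*-identityʳ p)) (sym (ℚ.*-identityʳ q)) p<q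
^ℚ-mono-< {p} {q} (suc n) 0<p p<q = ℚ.<-trans
  (ℚ.*-monoʳ-<-pos p {{ℚ.positive 0<p}} (^ℚ-mono-< n 0<p p<q))
  (ℚ.*-monoˡ-<-pos (q ^ℚ suc n) {{ℚ.positive (^ℚ-pos (suc n) (ℚ.<-trans 0<p p<q))}} p<q)

-- Rational bounds on reals

infix 4 _∈[_,_]

-- The closed interval is expressed through the cuts, so that enclosures can be weakened and
-- compared by rational inequalities alone.
record _∈[_,_] (x : ℝ) (a b : ℚ) : Set where
  constructor bounds
  field
    lower≤ : ∀ {q} → lower x q → q ℚ.≤ b
    ≤upper : ∀ {q} → upper x q → a ℚ.≤ q

open _∈[_,_]

-- Locatedness between p and a leaves only the case x < a to refute, and openness of the upper cut
-- then yields an upper bound of x strictly below a.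
<⇒lower : ∀ {x a b p} → x ∈[ a , b ] → p ℚ.< a → lower x p
<⇒lower {x} x∈ p<a with located x p<a
... | inj₁ p<x = p<x
... | inj₂ x<a = let q , q<a , x<q = upper-open x x<a
                 in ⊥-elim (<⇒≱ q<a (≤upper x∈ x<q))

<⇒upper : ∀ {x a b q} → x ∈[ a , b ] → b ℚ.< q → upper x q
<⇒upper {x} x∈ b<q with located x b<q
... | inj₂ x<q = x<q
... | inj₁ b<x = let p , b<p , p<x = lower-open x b<x
                 in ⊥-elim (<⇒≱ b<p (lower≤ x∈ p<x))

-- Used in both directions to turn two enclosures of the same real, one from a convergent and one
-- from a stage of the construction, into integer inequalities.
∈-overlap : ∀ {x a b c d} → x ∈[ a , b ] → x ∈[ c , d ] → a ℚ.≤ d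
∈-overlap {x} {a} {b} {c} {d} x∈ab x∈cd = ℚ.≮⇒≥ λ d<a →
  let p , d<p , p<x = lower-open x (<⇒lower x∈ab d<a)
  in <⇒≱ d<p (lower≤ x∈cd p<x)

∈-weaken : ∀ {x a b a′ b′} → a′ ℚ.≤ a → b ℚ.≤ b′ → x ∈[ a , b ] → x ∈[ a′ , b′ ]
∈-weaken a′≤a b≤b′ (bounds lower≤ ≤upper) =
  bounds (λ q<x → ℚ.≤-trans (lower≤ q<x) b≤b′) (λ x<q → ℚ.≤-trans a′≤a (≤upper x<q))

module _ {x : ℝ} {a b r ε s : ℚ} where

  private
    open +-*-Solver
    e₁ : ∀ r δ η → r ℚ.+ δ ℚ.+ (ℚ.- r ℚ.+ (η ℚ.- δ)) ≡ η
    e₁ = solve 3 (λ r δ η → r :+ δ :+ (:- r :+ (η :- δ)) := η) refl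
    e₂ : ∀ r δ η → r ℚ.- δ ℚ.+ (ℚ.- r ℚ.- (η ℚ.- δ)) ≡ ℚ.- η
    e₂ = solve 3 (λ r δ η → r :- δ :+ (:- r :- (η :- δ)) := :- η) refl
    e₃ : ∀ r θ → ℚ.- (ℚ.- r ℚ.+ θ) ≡ r ℚ.- θ
    e₃ = solve 2 (λ r θ → :- (:- r :+ θ) := r :- θ) refl
    e₄ : ∀ r θ → ℚ.- (ℚ.- r ℚ.- θ) ≡ r ℚ.+ θ
    e₄ = solve 2 (λ r θ → :- (:- r :- θ) := r :+ θ) refl
    e₅ : ∀ a δ → a ℚ.+ δ ℚ.- δ ≡ a
    e₅ = solve 2 (λ a δ → a :+ δ :- δ := a) refl

  -- An upper bound on the absolute value needs one on x - r and one on r - x, each a sum of two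
  -- strict bounds. With ε < δ < η < q, the share δ goes to x, and η - δ > 0 pays for strictness on
  -- the side of r.
  distance< : x ∈[ a , b ] → r ℚ.≤ a ℚ.+ ε → b ℚ.≤ r ℚ.+ ε → ε ℚ.< s →
              ∃[ q ] upper ∣ x -ℝ fromℚ r ∣ q × q ℚ.< s
  distance< x∈ r≤a+ε b≤r+ε ε<s with ℚ.<-dense ε<s
  ... | q , ε<q , q<s with ℚ.<-dense ε<q
  ... | η , ε<η , η<q with ℚ.<-dense ε<η
  ... | δ , ε<δ , δ<η = q ,
    ( (r ℚ.+ δ , ℚ.- r ℚ.+ (η ℚ.- δ)
      , <⇒upper x∈ (ℚ.≤-<-trans b≤r+ε (ℚ.+-monoʳ-< r ε<δ))
      , subst₂ ℚ._<_ (sym (e₃ r (η ℚ.- δ))) (ℚ.+-identityʳ r) (ℚ.+-monoʳ-< r (ℚ.neg-antimono-< 0<θ))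
      , subst (ℚ._< q) (sym (e₁ r δ η)) η<q)
    , (r ℚ.- δ , ℚ.- r ℚ.- (η ℚ.- δ)
      , <⇒lower x∈ (subst (r ℚ.- δ ℚ.<_) (e₅ a δ)
          (ℚ.+-monoˡ-< (ℚ.- δ) (ℚ.≤-<-trans r≤a+ε (ℚ.+-monoʳ-< a ε<δ))))
      , subst₂ ℚ._<_ (ℚ.+-identityʳ r) (sym (e₄ r (η ℚ.- δ))) (ℚ.+-monoʳ-< r 0<θ)
      , subst (ℚ.- q ℚ.<_) (sym (e₂ r δ η)) (ℚ.neg-antimono-< η<q)))
    , q<s
    where
    0<θ : 0ℚ ℚ.< η ℚ.- δ
    0<θ = subst (ℚ._< η ℚ.- δ) (ℚ.+-inverseʳ δ) (ℚ.+-monoˡ-< (ℚ.- δ) δ<η)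

-- The endpoints are i/m ∓ w/(m t) over the common denominator m t, and the integer hypothesis is
-- w/(m t) < 1/hⁿ with denominators cleared.
close-to-centre : ∀ {x} i m t w h n .{{_ : NonZero m}} .{{_ : NonZero (m ℕ.* t)}} .{{_ : NonZero h}} →
  x ∈[ (i ℤ.* + t ℤ.- + w) ℚ./ (m ℕ.* t) , (i ℤ.* + t ℤ.+ + w) ℚ./ (m ℕ.* t) ] →
  w ℕ.* h ℕ.^ n ℕ.< m ℕ.* t →
  ∃[ q ] upper ∣ x -ℝ fromℚ (i ℚ./ m) ∣ q × q ℚ.< (+ 1 ℚ./ h) ^ℚ n
close-to-centre {x} i m t w h n x∈ whⁿ<mt = distance< x∈
  (ℚ.≤-reflexive (sym (begin
    (i ℤ.* + t ℤ.- + w) ℚ./ (m ℕ.* t) ℚ.+ + w ℚ./ (m ℕ.* t) ≡⟨ /-+-same (i ℤ.* + t ℤ.- + w) (+ w) (m ℕ.* t) ⟩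
    (i ℤ.* + t ℤ.- + w ℤ.+ + w) ℚ./ (m ℕ.* t)               ≡⟨ cong (ℚ._/ (m ℕ.* t)) (cancel (i ℤ.* + t) (+ w)) ⟩
    (i ℤ.* + t) ℚ./ (m ℕ.* t)                               ≡⟨ /-expand i m t ⟩
    i ℚ./ m                                                 ∎)))
  (ℚ.≤-reflexive (begin
    (i ℤ.* + t ℤ.+ + w) ℚ./ (m ℕ.* t)               ≡⟨ /-+-same (i ℤ.* + t) (+ w) (m ℕ.* t) ⟨
    (i ℤ.* + t) ℚ./ (m ℕ.* t) ℚ.+ + w ℚ./ (m ℕ.* t) ≡⟨ cong (ℚ._+ + w ℚ./ (m ℕ.* t)) (/-expand i m t) ⟩
    i ℚ./ m ℚ.+ + w ℚ./ (m ℕ.* t)                   ∎))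
  (subst (+ w ℚ./ (m ℕ.* t) ℚ.<_) (sym (1/^ h n))
    (/-mono-< (+ w) (+ 1) (m ℕ.* t) (h ℕ.^ n)
      (subst₂ ℤ._<_ (ℤ.pos-* w (h ℕ.^ n)) (sym (ℤ.*-identityˡ (+ (m ℕ.* t)))) (ℤ.+<+ whⁿ<mt))))
  where
  open ≡-Reasoning
  instance
    _ = ℕ.m^n≢0 h n
  cancel : ∀ a b → a ℤ.- b ℤ.+ b ≡ a
  cancel = ℤSolver.solve-∀

-- The rational exponent −(n+1) below −n is an integer, so no root is needed.
<ℝ-negPower : ∀ {x h n} .{{_ : NonZero h}} →
  (∃[ q ] upper x q × q ℚ.< (+ 1 ℚ./ h) ^ℚ suc n) → x <ℝ h ^ℝ (-ℝ fromℚ (ι n))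
<ℝ-negPower {x} {h} {n} (q , x<q , q<s) = q , x<q
  , mkℚ -[1+ n ] 0 (ℕ.sym (1-coprimeTo (suc n))) , (+ 1 ℚ./ h) ^ℚ suc n
  , subst (ι n ℚ.<_) (ι≡mkℚ (suc n)) (ι-mono-< ℕ.≤-refl)
  , ^ℚ-pos (suc n) (0<1/ h)
  , ℚ.≤-reflexive (ℚ.*-identityʳ _)
  , q<s
  where
  0<1/ : ∀ h .{{_ : NonZero h}} → 0ℚ ℚ.< + 1 ℚ./ h
  0<1/ h = /-mono-< (+ 0) (+ 1) 1 h (ℤ.+<+ ℕ.z<s)

-- A rational q < H above h^x comes with i/d above x and s < q such that h^i ≤ s^d. Then m d ≤ i, so
-- s^d < H^d ≤ h^(m d) ≤ h^i, a contradiction.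
≤ℝ-power : ∀ {H h m x} .{{_ : NonZero h}} → H ℕ.≤ h ℕ.^ m →
           (∀ {r} → upper x r → ι m ℚ.≤ r) → fromℚ (ι H) ≤ℝ h ^ℝ x
≤ℝ-power {H} {h} {m} H≤h^m m≤x (q , (r@(mkℚ i d-1 _) , s , x<r , 0<s , hⁱ≤sᵈ , s<q) , q<H) =
  go i (ι≤⇒ m r (m≤x x<r)) hⁱ≤sᵈ
  where
  d : ℕ
  d = suc d-1

  -- The exponent is split by sign because `h ^ℤ i` computes only on constructors; a negative one
  -- contradicts 0 ≤ m d.
  go : ∀ i → + m ℤ.* + d ℤ.≤ i → h ^ℤ i ℚ.≤ s ^ℚ d → ⊥
  go -[1+ n ] md≤i = ⊥-elim (ℤ.<⇒≱ ℤ.-<+ (subst (ℤ._≤ -[1+ n ]) (sym (ℤ.pos-* m d)) md≤i))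
  go (+ n) md≤n hⁿ≤sᵈ = ℚ.<-irrefl refl (begin-strict
    s ^ℚ d            <⟨ ^ℚ-mono-< d-1 0<s (ℚ.<-trans s<q q<H) ⟩
    ι H ^ℚ d          ≡⟨ ι-^ H d ⟩
    ι (H ℕ.^ d)       ≤⟨ ι-mono-≤ (ℕ.^-monoˡ-≤ d H≤h^m) ⟩
    ι ((h ℕ.^ m) ℕ.^ d) ≡⟨ cong ι (ℕ.^-*-assoc h m d) ⟩
    ι (h ℕ.^ (m ℕ.* d)) ≤⟨ ι-mono-≤ (ℕ.^-monoʳ-≤ h (ℤ.drop‿+≤+ (subst (ℤ._≤ + n) (sym (ℤ.pos-* m d)) md≤n))) ⟩
    ι (h ℕ.^ n)       ≡⟨ ι-^ h n ⟨
    ι h ^ℚ n          ≡⟨ cong (_^ℚ n) (ι≡/ h) ⟩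
    h ^ℤ (+ n)        ≤⟨ hⁿ≤sᵈ ⟩
    s ^ℚ d            ∎)
    where open ℚ.≤-Reasoning

-- Membership in `𝓛` from natural exponents

fromℕ⁺ : ∀ n → 0 ℕ.< n → ℝ⁺
fromℕ⁺ n 0<n = fromℚ (ι n) , ℚ.<-dense (0<ι 0<n)

upper-*⁺ : ∀ m n 0<m 0<n {r} → upper (proj₁ (fromℕ⁺ m 0<m *⁺ fromℕ⁺ n 0<n)) r → ι (m ℕ.* n) ℚ.≤ r
upper-*⁺ m n 0<m 0<n {r} (a , b , m<a , n<b , ab<r) = ℚ.<⇒≤ (ℚ.≤-<-trans (begin
  ι (m ℕ.* n) ≡⟨ ι-* m n ⟨
  ι m ℚ.* ι n ≤⟨ ℚ.*-monoˡ-≤-nonNeg (ι m) {{ℚ.nonNegative (0≤ι m)}} (ℚ.<⇒≤ n<b) ⟩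
  ι m ℚ.* b   ≤⟨ ℚ.*-monoʳ-≤-nonNeg b {{ℚ.nonNegative (ℚ.≤-trans (0≤ι n) (ℚ.<⇒≤ n<b))}} (ℚ.<⇒≤ m<a) ⟩
  a ℚ.* b     ∎) ab<r)
  where open ℚ.≤-Reasoning

module _ (ξ : ℝ) (r : ℕ → ℚ) (ω : ℕ → ℕ) (C : ℕ) where

  -- Serves both halves of the theorem. Closeness is asked with exponent `suc (ω n)` because
  -- `<ℝ-negPower` goes through the next integer exponent. Unbounded denominators give infinitely
  -- many values, since a finite list has a largest denominator.
  𝓛-intro : 0 ℕ.< C → (∀ n → 0 ℕ.< ω n) →
    (∀ M → ∃[ N ] ∀ n → n ℕ.≥ N → M ℕ.≤ ω n) →
    (∀ M → ∃[ n ] M ℕ.< ↧ₙ r n) →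
    (∀ n → ∃[ q ] upper ∣ ξ -ℝ fromℚ (r n) ∣ q ×
       q ℚ.< (+ 1 ℚ./ height (r n)) {{height-nonZero (r n)}} ^ℚ suc (ω n)) →
    (∀ n → height (r (suc n)) ℕ.≤ height (r n) ℕ.^ (C ℕ.* ω n)) →
    𝓛 ξ
  𝓛-intro 0<C 0<ω ω→∞ denominators close heights =
    (λ n → fromℕ⁺ (ω n) (0<ω n)) , r , fromℕ⁺ C 0<C , tends , infinite
    , (λ n → <ℝ-negPower {∣ ξ -ℝ fromℚ (r n) ∣} {n = ω n} {{height-nonZero (r n)}} (close n))
    , growth
    where
    growth : ∀ n → fromℚ (+ height (r (suc n)) ℚ./ 1) ≤ℝ
             heightPower (r n) (proj₁ (fromℕ⁺ C 0<C *⁺ fromℕ⁺ (ω n) (0<ω n)))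
    growth n = subst (λ p → fromℚ p ≤ℝ heightPower (r n) Cω) (ι≡/ (height (r (suc n))))
      (≤ℝ-power {m = C ℕ.* ω n} {x = Cω} {{height-nonZero (r n)}} (heights n)
        (λ {q} → upper-*⁺ C (ω n) 0<C (0<ω n) {q}))
      where
      Cω : ℝ
      Cω = proj₁ (fromℕ⁺ C 0<C *⁺ fromℕ⁺ (ω n) (0<ω n))

    tends : TendsToInfinity (λ n → fromℚ (ι (ω n)))
    tends x with upper-inhabited x
    ... | p , x<p with archimedean p
    ... | M , p<M with ω→∞ M
    ... | N , M≤ω = N , λ n n≥N → p , x<p , ℚ.<-≤-trans p<M (ι-mono-≤ (M≤ω n n≥N))

    bound : List ℚ → ℕ
    bound []       = 0
    bound (p ∷ ps) = ↧ₙ p ℕ.⊔ bound ps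

    bound-∉ : ∀ ps {p} → bound ps ℕ.< ↧ₙ p → p ∉ ps
    bound-∉ (p ∷ ps) b<p (here refl) = ℕ.<⇒≱ b<p (ℕ.m≤m⊔n (↧ₙ p) (bound ps))
    bound-∉ (p ∷ ps) b<p (there p∈)  =
      bound-∉ ps (ℕ.≤-<-trans (ℕ.m≤n⊔m (↧ₙ p) (bound ps)) b<p) p∈

    infinite : InfinitelyManyValues r
    infinite ps = let n , b<r = denominators (bound ps) in n , bound-∉ ps b<r

module _ i n .{{_ : NonZero n}} (c : Coprime ℤ.∣ i ∣ n) where

  private
    gcd≡1 : ℤ.gcd i (+ n) ≡ + 1
    gcd≡1 = cong +_ (ℕ.coprime⇒gcd≡1 c)

  ↥-coprime : ↥ (i ℚ./ n) ≡ i
  ↥-coprime = trans (sym (ℤ.*-identityʳ (↥ (i ℚ./ n))))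
    (trans (cong (↥ (i ℚ./ n) ℤ.*_) (sym gcd≡1)) (ℚ.↥-/ i n))

  ↧-coprime : ↧ₙ (i ℚ./ n) ≡ n
  ↧-coprime = ℤ.+-injective (trans (sym (ℤ.*-identityʳ (↧ (i ℚ./ n))))
    (trans (cong (↧ (i ℚ./ n) ℤ.*_) (sym gcd≡1)) (ℚ.↧-/ i n)))

  height-coprime : height (i ℚ./ n) ≡ ℤ.∣ i ∣ ℕ.⊔ n
  height-coprime = cong₂ (λ j m → ℤ.∣ j ∣ ℕ.⊔ m) ↥-coprime ↧-coprime

lower-upper-⊥ : ∀ x {p q} → lower x p → upper x q → ¬ q ℚ.≤ p
lower-upper-⊥ x {p} {q} p<x x<q q≤p with lower-open x p<x
... | r , p<r , r<x = disjoint x r<x (upper-closed x (ℚ.≤-<-trans q≤p p<r) x<q)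

-- If b < r < ξ, some s n ≤ b lies within r - b of ξ, which forces ξ < r; the other side is
-- symmetric.
limit-∈ : ∀ {s ξ a b} K → ConvergesTo (fromℚ ∘ s) ξ →
          (∀ n → n ℕ.≥ K → a ℚ.≤ s n × s n ℚ.≤ b) → ξ ∈[ a , b ]
limit-∈ {s} {ξ} {a} {b} K s→ξ s∈ab = bounds (λ r<ξ → ℚ.≮⇒≥ (not-above r<ξ)) (λ ξ<r → ℚ.≮⇒≥ (not-below ξ<r))
  where
  open ℚ.≤-Reasoning

  near : ∀ {p q} → p ℚ.< q → ∃[ n ] (a ℚ.≤ s n × s n ℚ.≤ b) × ∣ fromℚ (s n) -ℝ ξ ∣ <ℝ fromℚ (q ℚ.- p)
  near {p} {q} p<q with s→ξ (fromℚ (q ℚ.- p) , ℚ.<-dense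
                          (subst (ℚ._< q ℚ.- p) (ℚ.+-inverseʳ p) (ℚ.+-monoˡ-< (ℚ.- p) p<q)))
  ... | N , close = K ℕ.⊔ N , s∈ab (K ℕ.⊔ N) (ℕ.m≤m⊔n K N) , close (K ℕ.⊔ N) (ℕ.m≤n⊔m K N)

  open +-*-Solver
  e₁ : ∀ q → ℚ.- (ℚ.- q) ≡ q
  e₁ = solve 1 (λ q → :- (:- q) := q) refl
  e₂ : ∀ u v → ℚ.- v ≡ u ℚ.- (u ℚ.+ v)
  e₂ = solve 2 (λ u v → :- v := u :- (u :+ v)) refl
  e₃ : ∀ b r → b ℚ.+ (r ℚ.- b) ≡ r
  e₃ = solve 2 (λ b r → b :+ (r :- b) := r) refl
  e₄ : ∀ a r → a ℚ.- (a ℚ.- r) ≡ r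
  e₄ = solve 2 (λ a r → a :- (a :- r) := r) refl
  e₅ : ∀ u v → ℚ.- v ≡ u ℚ.+ ℚ.- (u ℚ.+ v)
  e₅ = solve 2 (λ u v → :- v := u :+ :- (u :+ v)) refl

  not-above : ∀ {r} → lower ξ r → ¬ b ℚ.< r
  not-above {r} r<ξ b<r with near b<r
  ... | n , (_ , sₙ≤b) , q , (_ , u , v , u<sₙ , ξ<-v , -q<u+v) , q<r-b =
    lower-upper-⊥ ξ r<ξ ξ<-v (begin
      ℚ.- v                        ≡⟨ e₅ u v ⟩
      u ℚ.+ ℚ.- (u ℚ.+ v)          ≤⟨ ℚ.+-mono-≤ (ℚ.<⇒≤ u<sₙ) (ℚ.neg-antimono-≤ (ℚ.<⇒≤ -q<u+v)) ⟩
      s n ℚ.+ ℚ.- (ℚ.- q)          ≡⟨ cong (s n ℚ.+_) (e₁ q) ⟩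
      s n ℚ.+ q                    ≤⟨ ℚ.+-mono-≤ sₙ≤b (ℚ.<⇒≤ q<r-b) ⟩
      b ℚ.+ (r ℚ.- b)              ≡⟨ e₃ b r ⟩
      r                            ∎)

  not-below : ∀ {r} → upper ξ r → ¬ r ℚ.< a
  not-below {r} ξ<r r<a with near r<a
  ... | n , (a≤sₙ , _) , q , ((u , v , sₙ<u , -v<ξ , u+v<q) , _) , q<a-r =
    lower-upper-⊥ ξ -v<ξ ξ<r (begin
      r                            ≡⟨ e₄ a r ⟨
      a ℚ.- (a ℚ.- r)              ≤⟨ ℚ.+-mono-≤ (ℚ.≤-trans a≤sₙ (ℚ.<⇒≤ sₙ<u))
                                        (ℚ.neg-antimono-≤ (ℚ.<⇒≤ (ℚ.<-trans u+v<q q<a-r))) ⟩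
      u ℚ.- (u ℚ.+ v)              ≡⟨ e₂ u v ⟨
      ℚ.- v                        ∎)

-- Continued fractions

module Convergents (c : ContinuedFraction) where

  open ContinuedFraction c renaming (numerator to p; denominator to q)

  0<q : ∀ k → 0 ℕ.< q k
  0<q k = ℕ.>-nonZero⁻¹ (q k) {{denominator-nonZero k}}

  0<a : ∀ k → 0 ℕ.< a₁₊ k
  0<a k = ℕ.>-nonZero⁻¹ (a₁₊ k) {{a₁₊-nonZero k}}

  qq≢0 : ∀ k → NonZero (q k ℕ.* q (suc k))
  qq≢0 k = ℕ.m*n≢0 (q k) (q (suc k)) {{denominator-nonZero k}} {{denominator-nonZero (suc k)}}

  -- The numerator of `convergent n` - `convergent k` over the denominator `q k * q n`.
  cross : ℕ → ℕ → ℤ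
  cross k n = p n ℤ.* + q k ℤ.- p k ℤ.* + q n

  q-rec : ∀ k → + q (suc (suc k)) ≡ + a₁₊ (suc k) ℤ.* + q (suc k) ℤ.+ + q k
  q-rec k = cong (ℤ._+ + q k) (ℤ.pos-* (a₁₊ (suc k)) (q (suc k)))

  cross-rec : ∀ k n → cross k (suc (suc n)) ≡ + a₁₊ (suc n) ℤ.* cross k (suc n) ℤ.+ cross k n
  cross-rec k n = trans
    (cong (λ Q → p (suc (suc n)) ℤ.* + q k ℤ.- p k ℤ.* Q) (q-rec n))
    (ring (+ a₁₊ (suc n)) (p (suc n)) (p n) (+ q k) (p k) (+ q (suc n)) (+ q n))
    where
    ring : ∀ a p₁ p₀ qₖ pₖ q₁ q₀ →
      (a ℤ.* p₁ ℤ.+ p₀) ℤ.* qₖ ℤ.- pₖ ℤ.* (a ℤ.* q₁ ℤ.+ q₀) ≡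
      a ℤ.* (p₁ ℤ.* qₖ ℤ.- pₖ ℤ.* q₁) ℤ.+ (p₀ ℤ.* qₖ ℤ.- pₖ ℤ.* q₀)
    ring = ℤSolver.solve-∀

  cross-refl : ∀ k → cross k k ≡ + 0
  cross-refl k = ℤ.+-inverseʳ (p k ℤ.* + q k)

  cross-sym : ∀ k n → ℤ.∣ cross k n ∣ ≡ ℤ.∣ cross n k ∣
  cross-sym k n = ℤ.∣i-j∣≡∣j-i∣ (p n ℤ.* + q k) (p k ℤ.* + q n)

  -- In the recurrence for `cross (suc k)` the middle term `cross (suc k) (suc k)` vanishes, so a
  -- step changes only the sign.
  ∣cross∣≡1 : ∀ k → ℤ.∣ cross k (suc k) ∣ ≡ 1
  ∣cross∣≡1 zero    = cong ℤ.∣_∣ (ring (+ a₁₊ 0) a₀)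
    where
    ring : ∀ a b → (a ℤ.* b ℤ.+ + 1) ℤ.* + 1 ℤ.- b ℤ.* a ≡ + 1
    ring = ℤSolver.solve-∀
  ∣cross∣≡1 (suc k) = begin
    ℤ.∣ cross (suc k) (suc (suc k)) ∣ ≡⟨ cong ℤ.∣_∣ (cross-rec (suc k) k) ⟩
    ℤ.∣ + a₁₊ (suc k) ℤ.* cross (suc k) (suc k) ℤ.+ cross (suc k) k ∣
      ≡⟨ cong (λ z → ℤ.∣ + a₁₊ (suc k) ℤ.* z ℤ.+ cross (suc k) k ∣) (cross-refl (suc k)) ⟩
    ℤ.∣ + a₁₊ (suc k) ℤ.* + 0 ℤ.+ cross (suc k) k ∣
      ≡⟨ cong (λ z → ℤ.∣ z ℤ.+ cross (suc k) k ∣) (ℤ.*-zeroʳ (+ a₁₊ (suc k))) ⟩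
    ℤ.∣ + 0 ℤ.+ cross (suc k) k ∣     ≡⟨ cong ℤ.∣_∣ (ℤ.+-identityˡ (cross (suc k) k)) ⟩
    ℤ.∣ cross (suc k) k ∣             ≡⟨ cross-sym (suc k) k ⟩
    ℤ.∣ cross k (suc k) ∣             ≡⟨ ∣cross∣≡1 k ⟩
    1                                 ∎
    where open ≡-Reasoning

  -- For fixed k, both cross k n and q n satisfy xₙ₊₂ = aₙ₊₂ xₙ₊₁ + xₙ.
  ∣cross∣-bound : ∀ k n → ℤ.∣ cross k (n ℕ.+ k) ∣ ℕ.* q (suc k) ℕ.≤ q (n ℕ.+ k)
  ∣cross∣-bound k zero = subst (λ z → ℤ.∣ z ∣ ℕ.* q (suc k) ℕ.≤ q k) (sym (cross-refl k)) ℕ.z≤n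
  ∣cross∣-bound k (suc zero) = ℕ.≤-reflexive
    (trans (cong (ℕ._* q (suc k)) (∣cross∣≡1 k)) (ℕ.*-identityˡ (q (suc k))))
  ∣cross∣-bound k (suc (suc n)) = begin
    ℤ.∣ cross k (suc (suc m)) ∣ ℕ.* Q
      ≡⟨ cong (λ z → ℤ.∣ z ∣ ℕ.* Q) (cross-rec k m) ⟩
    ℤ.∣ + a ℤ.* cross k (suc m) ℤ.+ cross k m ∣ ℕ.* Q
      ≤⟨ ℕ.*-monoˡ-≤ Q (ℤ.∣i+j∣≤∣i∣+∣j∣ (+ a ℤ.* cross k (suc m)) (cross k m)) ⟩
    (ℤ.∣ + a ℤ.* cross k (suc m) ∣ ℕ.+ ℤ.∣ cross k m ∣) ℕ.* Q
      ≡⟨ ℕ.*-distribʳ-+ Q ℤ.∣ + a ℤ.* cross k (suc m) ∣ ℤ.∣ cross k m ∣ ⟩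
    ℤ.∣ + a ℤ.* cross k (suc m) ∣ ℕ.* Q ℕ.+ ℤ.∣ cross k m ∣ ℕ.* Q
      ≡⟨ cong (λ z → z ℕ.* Q ℕ.+ ℤ.∣ cross k m ∣ ℕ.* Q) (ℤ.abs-* (+ a) (cross k (suc m))) ⟩
    a ℕ.* ℤ.∣ cross k (suc m) ∣ ℕ.* Q ℕ.+ ℤ.∣ cross k m ∣ ℕ.* Q
      ≡⟨ cong (ℕ._+ ℤ.∣ cross k m ∣ ℕ.* Q) (ℕ.*-assoc a ℤ.∣ cross k (suc m) ∣ Q) ⟩
    a ℕ.* (ℤ.∣ cross k (suc m) ∣ ℕ.* Q) ℕ.+ ℤ.∣ cross k m ∣ ℕ.* Q
      ≤⟨ ℕ.+-mono-≤ (ℕ.*-monoʳ-≤ a (∣cross∣-bound k (suc n))) (∣cross∣-bound k n) ⟩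
    a ℕ.* q (suc m) ℕ.+ q m ∎
    where
    open ℕ.≤-Reasoning
    m a Q : ℕ
    m = n ℕ.+ k
    a = a₁₊ (suc m)
    Q = q (suc k)

  lo hi : ℕ → ℚ
  lo k = ((p k ℤ.* + q (suc k) ℤ.- + 1) ℚ./ (q k ℕ.* q (suc k))) {{qq≢0 k}}
  hi k = ((p k ℤ.* + q (suc k) ℤ.+ + 1) ℚ./ (q k ℕ.* q (suc k))) {{qq≢0 k}}

  -- Dividing `∣cross∣-bound` by q k · q n · q (k+1) bounds the distance between the two convergents
  -- by 1/(q k · q (k+1)).
  convergent-∈ : ∀ k n → n ℕ.≥ k → lo k ℚ.≤ convergent n × convergent n ℚ.≤ hi k
  convergent-∈ k n n≥k =
      /-mono-≤ (p k ℤ.* + Q ℤ.- + 1) (p n) (q k ℕ.* Q) (q n)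
        (ℤ.0≤i-j⇒j≤i (subst (+ 0 ℤ.≤_) (e₁ (p n) (p k) (+ q n) (+ q k) (+ Q) (ℤ.pos-* (q k) Q))
          (ℤ.i≤j⇒0≤j-i (ℤ.≤-trans (i≤∣i∣ (ℤ.- (cross k n ℤ.* + Q)))
            (ℤ.+≤+ (subst (ℕ._≤ q n) (sym (ℤ.∣-i∣≡∣i∣ (cross k n ℤ.* + Q))) ∣≤∣))))))
    , /-mono-≤ (p n) (p k ℤ.* + Q ℤ.+ + 1) (q n) (q k ℕ.* Q)
        (ℤ.0≤i-j⇒j≤i (subst (+ 0 ℤ.≤_) (e₂ (p n) (p k) (+ q n) (+ q k) (+ Q) (ℤ.pos-* (q k) Q))
          (ℤ.i≤j⇒0≤j-i (ℤ.≤-trans (i≤∣i∣ (cross k n ℤ.* + Q)) (ℤ.+≤+ ∣≤∣)))))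
    where
    Q : ℕ
    Q = q (suc k)

    instance
      _ = denominator-nonZero n
      _ = qq≢0 k

    ∣≤∣ : ℤ.∣ cross k n ℤ.* + Q ∣ ℕ.≤ q n
    ∣≤∣ = subst (ℕ._≤ q n) (sym (ℤ.abs-* (cross k n) (+ Q)))
      (subst (λ m → ℤ.∣ cross k m ∣ ℕ.* Q ℕ.≤ q m) (ℕ.m∸n+n≡m n≥k) (∣cross∣-bound k (n ℕ.∸ k)))

    s₁ : ∀ pₙ pₖ qₙ qₖ Q →
      qₙ ℤ.- ℤ.- ((pₙ ℤ.* qₖ ℤ.- pₖ ℤ.* qₙ) ℤ.* Q) ≡ pₙ ℤ.* (qₖ ℤ.* Q) ℤ.- (pₖ ℤ.* Q ℤ.- + 1) ℤ.* qₙ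
    s₁ = ℤSolver.solve-∀
    e₁ : ∀ pₙ pₖ qₙ qₖ Q {qQ} → qQ ≡ qₖ ℤ.* Q →
      qₙ ℤ.- ℤ.- ((pₙ ℤ.* qₖ ℤ.- pₖ ℤ.* qₙ) ℤ.* Q) ≡ pₙ ℤ.* qQ ℤ.- (pₖ ℤ.* Q ℤ.- + 1) ℤ.* qₙ
    e₁ pₙ pₖ qₙ qₖ Q refl = s₁ pₙ pₖ qₙ qₖ Q
    s₂ : ∀ pₙ pₖ qₙ qₖ Q →
      qₙ ℤ.- (pₙ ℤ.* qₖ ℤ.- pₖ ℤ.* qₙ) ℤ.* Q ≡ (pₖ ℤ.* Q ℤ.+ + 1) ℤ.* qₙ ℤ.- pₙ ℤ.* (qₖ ℤ.* Q)
    s₂ = ℤSolver.solve-∀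
    e₂ : ∀ pₙ pₖ qₙ qₖ Q {qQ} → qQ ≡ qₖ ℤ.* Q →
      qₙ ℤ.- (pₙ ℤ.* qₖ ℤ.- pₖ ℤ.* qₙ) ℤ.* Q ≡ (pₖ ℤ.* Q ℤ.+ + 1) ℤ.* qₙ ℤ.- pₙ ℤ.* qQ
    e₂ pₙ pₖ qₙ qₖ Q refl = s₂ pₙ pₖ qₙ qₖ Q

  expansion-∈ : ∀ {ξ} → c IsExpansionOf ξ → ∀ k → ξ ∈[ lo k , hi k ]
  expansion-∈ c→ξ k = limit-∈ k c→ξ (convergent-∈ k)

  -- A common divisor divides `cross k (suc k)`, which is ±1.
  coprime : ∀ k → Coprime ℤ.∣ p k ∣ (q k)
  coprime k {d} (d∣p , d∣q) = ℕ.∣1⇒≡1 (subst (d ℕ.∣_) (∣cross∣≡1 k)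
    (ℤ.∣⇒∣ᵤ {+ d} {cross k (suc k)} (ℤ.∣m∣n⇒∣m-n
      (ℤ.∣n⇒∣m*n (p (suc k)) (ℤ.∣ᵤ⇒∣ {+ d} {+ q k} d∣q))
      (ℤ.∣m⇒∣m*n (+ q (suc k)) (ℤ.∣ᵤ⇒∣ {+ d} {p k} d∣p)))))

  q-mono-suc : ∀ k → q k ℕ.≤ q (suc k)
  q-mono-suc zero    = 0<a 0
  q-mono-suc (suc k) = ℕ.≤-trans (ℕ.m≤n*m (q (suc k)) (a₁₊ (suc k)) {{a₁₊-nonZero (suc k)}}) (ℕ.m≤m+n _ (q k))

  q-mono : ∀ {k n} → k ℕ.≤ n → q k ℕ.≤ q n
  q-mono {k} k≤n = go (ℕ.≤⇒≤′ k≤n)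
    where
    go : ∀ {n} → k ℕ.≤′ n → q k ℕ.≤ q n
    go ℕ.≤′-refl     = ℕ.≤-refl
    go (ℕ.≤′-step {n} k≤n) = ℕ.≤-trans (go k≤n) (q-mono-suc n)

  k≤q : ∀ k → k ℕ.≤ q k
  k≤q zero          = ℕ.z≤n
  k≤q (suc zero)    = 0<a 0
  k≤q (suc (suc k)) = begin
    suc (suc k)                           ≡⟨ ℕ.+-comm 1 (suc k) ⟩
    suc k ℕ.+ 1                           ≤⟨ ℕ.+-mono-≤ (ℕ.≤-trans (k≤q (suc k)) (ℕ.m≤n*m (q (suc k)) (a₁₊ (suc k)) {{a₁₊-nonZero (suc k)}})) (0<q k) ⟩
    a₁₊ (suc k) ℕ.* q (suc k) ℕ.+ q k     ∎
    where open ℕ.≤-Reasoning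

  -- The successor leaves room for the `+ 1` in the numerator at index 1; the recurrence then
  -- preserves the bound |p| ≤ A q.
  A : ℕ
  A = suc ℤ.∣ a₀ ∣

  ∣p∣≤A*q : ∀ k → ℤ.∣ p k ∣ ℕ.≤ A ℕ.* q k
  ∣p∣≤A*q zero = subst (ℤ.∣ a₀ ∣ ℕ.≤_) (sym (ℕ.*-identityʳ A)) (ℕ.n≤1+n ℤ.∣ a₀ ∣)
  ∣p∣≤A*q (suc zero) = begin
    ℤ.∣ + a₁₊ 0 ℤ.* a₀ ℤ.+ + 1 ∣       ≤⟨ ℤ.∣i+j∣≤∣i∣+∣j∣ (+ a₁₊ 0 ℤ.* a₀) (+ 1) ⟩
    ℤ.∣ + a₁₊ 0 ℤ.* a₀ ∣ ℕ.+ 1         ≡⟨ cong (ℕ._+ 1) (ℤ.abs-* (+ a₁₊ 0) a₀) ⟩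
    a₁₊ 0 ℕ.* ℤ.∣ a₀ ∣ ℕ.+ 1           ≤⟨ ℕ.+-monoʳ-≤ (a₁₊ 0 ℕ.* ℤ.∣ a₀ ∣) (0<a 0) ⟩
    a₁₊ 0 ℕ.* ℤ.∣ a₀ ∣ ℕ.+ a₁₊ 0       ≡⟨ ℕ.+-comm (a₁₊ 0 ℕ.* ℤ.∣ a₀ ∣) (a₁₊ 0) ⟩
    a₁₊ 0 ℕ.+ a₁₊ 0 ℕ.* ℤ.∣ a₀ ∣       ≡⟨ ℕ.*-suc (a₁₊ 0) ℤ.∣ a₀ ∣ ⟨
    a₁₊ 0 ℕ.* A                        ≡⟨ ℕ.*-comm (a₁₊ 0) A ⟩
    A ℕ.* a₁₊ 0                        ∎
    where open ℕ.≤-Reasoning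
  ∣p∣≤A*q (suc (suc k)) = begin
    ℤ.∣ + a ℤ.* p (suc k) ℤ.+ p k ∣             ≤⟨ ℤ.∣i+j∣≤∣i∣+∣j∣ (+ a ℤ.* p (suc k)) (p k) ⟩
    ℤ.∣ + a ℤ.* p (suc k) ∣ ℕ.+ ℤ.∣ p k ∣       ≡⟨ cong (ℕ._+ ℤ.∣ p k ∣) (ℤ.abs-* (+ a) (p (suc k))) ⟩
    a ℕ.* ℤ.∣ p (suc k) ∣ ℕ.+ ℤ.∣ p k ∣         ≤⟨ ℕ.+-mono-≤ (ℕ.*-monoʳ-≤ a (∣p∣≤A*q (suc k))) (∣p∣≤A*q k) ⟩
    a ℕ.* (A ℕ.* q (suc k)) ℕ.+ A ℕ.* q k       ≡⟨ cong (ℕ._+ A ℕ.* q k) (x∙yz≈y∙xz ℕ.*-commutativeSemigroup a A (q (suc k))) ⟩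
    A ℕ.* (a ℕ.* q (suc k)) ℕ.+ A ℕ.* q k       ≡⟨ ℕ.*-distribˡ-+ A (a ℕ.* q (suc k)) (q k) ⟨
    A ℕ.* (a ℕ.* q (suc k) ℕ.+ q k)             ∎
    where
    open ℕ.≤-Reasoning
    a : ℕ
    a = a₁₊ (suc k)

  height≤A*q : ∀ k → height (convergent k) ℕ.≤ A ℕ.* q k
  height≤A*q k = subst (ℕ._≤ A ℕ.* q k) (sym (height-coprime (p k) (q k) {{denominator-nonZero k}} (coprime k)))
    (ℕ.⊔-lub (∣p∣≤A*q k) (ℕ.m≤n*m (q k) A))

  q≤height : ∀ k → q k ℕ.≤ height (convergent k)
  q≤height k = subst (q k ℕ.≤_) (sym (height-coprime (p k) (q k) {{denominator-nonZero k}} (coprime k))) (ℕ.m≤n⊔m ℤ.∣ p k ∣ (q k))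

-- A downward search from n. It serves as an integer logarithm in `log`, and it locates D² among the
-- denominators of convergents in `D-is-denominator`.
bracket : ∀ (f : ℕ → ℕ) {x} → f 0 ℕ.≤ x → ∀ n → x ℕ.< f n → ∃[ k ] f k ℕ.≤ x × x ℕ.< f (suc k)
bracket f f0≤x zero    x<f0 = ⊥-elim (ℕ.<⇒≱ x<f0 f0≤x)
bracket f {x} f0≤x (suc n) x<f with f n ℕ.≤? x
... | yes fn≤x = n , fn≤x , x<f
... | no  fn≰x = bracket f f0≤x n (ℕ.≰⇒> fn≰x)

n<b^n : ∀ {b} n → 2 ℕ.≤ b → n ℕ.< b ℕ.^ n
n<b^n         zero    2≤b = ℕ.s≤s ℕ.z≤n
n<b^n {b} (suc n) 2≤b = begin-strict
  suc n                 ≤⟨ n<b^n n 2≤b ⟩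
  b ℕ.^ n               <⟨ ℕ.m<m+n (b ℕ.^ n) (ℕ.≤-<-trans ℕ.z≤n (n<b^n n 2≤b)) ⟩
  b ℕ.^ n ℕ.+ b ℕ.^ n   ≡⟨ cong (b ℕ.^ n ℕ.+_) (ℕ.+-identityʳ (b ℕ.^ n)) ⟨
  2 ℕ.* b ℕ.^ n         ≤⟨ ℕ.*-monoˡ-≤ (b ℕ.^ n) 2≤b ⟩
  b ℕ.* b ℕ.^ n         ∎
  where open ℕ.≤-Reasoning

x²^n≡x^2n : ∀ x n → (x ℕ.* x) ℕ.^ n ≡ x ℕ.^ (2 ℕ.* n)
x²^n≡x^2n x n = trans (cong (ℕ._^ n) (cong (x ℕ.*_) (sym (ℕ.*-identityʳ x)))) (ℕ.^-*-assoc x 2 n)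

-- Strong Liouville numbers lie in `𝓛`

module StrongLiouvilleExpansion {ξ} (c : ContinuedFraction) (c→ξ : c IsExpansionOf ξ)
  (strong : ∀ n → n ℕ.≥ 1 → ∃[ N ] ∀ k → k ℕ.> N →
     ContinuedFraction.denominator c (suc k) ℕ.> ContinuedFraction.denominator c k ℕ.^ n)
  where

  open ContinuedFraction c renaming (numerator to p; denominator to q)
  open Convergents c

  private

    -- From index K on, q k is at least 2 and A, and q (suc k) > q k ^ 4.
    N₄ K : ℕ
    N₄ = proj₁ (strong 4 (ℕ.s≤s ℕ.z≤n))
    K  = suc N₄ ℕ.+ (2 ℕ.+ A)

    index : ℕ → ℕ
    index n = n ℕ.+ K

    r : ℕ → ℚ
    r n = convergent (index n)

    Q Q′ H : ℕ → ℕ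
    Q n  = q (index n)
    Q′ n = q (suc (index n))
    H n  = height (r n)

    2+A≤Q : ∀ n → 2 ℕ.+ A ℕ.≤ Q n
    2+A≤Q n = ℕ.≤-trans (ℕ.≤-trans (ℕ.m≤n+m (2 ℕ.+ A) (suc N₄)) (ℕ.m≤n+m K n)) (k≤q (index n))

    2≤Q : ∀ n → 2 ℕ.≤ Q n
    2≤Q n = ℕ.≤-trans (ℕ.m≤m+n 2 A) (2+A≤Q n)

    A≤Q : ∀ n → A ℕ.≤ Q n
    A≤Q n = ℕ.≤-trans (ℕ.m≤n+m A 2) (2+A≤Q n)

    2≤H : ∀ n → 2 ℕ.≤ H n
    2≤H n = ℕ.≤-trans (2≤Q n) (q≤height (index n))

    H≤Q² : ∀ n → H n ℕ.≤ Q n ℕ.* Q n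
    H≤Q² n = ℕ.≤-trans (height≤A*q (index n)) (ℕ.*-monoˡ-≤ (Q n) (A≤Q n))

    -- Lower bounds on Q′ by powers of Q become lower bounds by powers of H with half the exponent;
    -- the constant A is absorbed by the second factor in `H≤Q²`.
    H^≤Q^ : ∀ n e → H n ℕ.^ e ℕ.≤ Q n ℕ.^ (2 ℕ.* e)
    H^≤Q^ n e = ℕ.≤-trans (ℕ.^-monoˡ-≤ e (H≤Q² n)) (ℕ.≤-reflexive (x²^n≡x^2n (Q n) e))

    -- The exponent 4 is twice 2: H² ≤ Q⁴ < Q′. This lets the search in `log` start at exponent 2,
    -- so that ω ≥ 1.
    H²≤Q′ : ∀ n → H n ℕ.^ 2 ℕ.≤ Q′ n
    H²≤Q′ n = ℕ.≤-trans (H^≤Q^ n 2) (ℕ.<⇒≤ (proj₂ (strong 4 (ℕ.s≤s ℕ.z≤n)) (index n)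
      (ℕ.≤-trans (ℕ.m≤m+n (suc N₄) (2 ℕ.+ A)) (ℕ.m≤n+m K n))))

    opaque

      log : ∀ n → ∃[ k ] H n ℕ.^ (2 ℕ.+ k) ℕ.≤ Q′ n × Q′ n ℕ.< H n ℕ.^ (3 ℕ.+ k)
      log n = bracket (λ k → H n ℕ.^ (2 ℕ.+ k)) (H²≤Q′ n) (Q′ n)
        (ℕ.<-≤-trans (n<b^n (Q′ n) (2≤H n))
          (ℕ.^-monoʳ-≤ (H n) {{height-nonZero (r n)}} (ℕ.m≤n+m (Q′ n) 2)))

    ω : ℕ → ℕ
    ω n = suc (proj₁ (log n))

    -- If ω < M, then Q′ < H^(ω+2) ≤ H^(2+M) ≤ Q^(2(2+M)), against the strong Liouville condition
    -- for that last exponent.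
    ω→∞ : ∀ M → ∃[ N ] ∀ n → n ℕ.≥ N → M ℕ.≤ ω n
    ω→∞ M with strong (2 ℕ.* (2 ℕ.+ M)) (ℕ.s≤s ℕ.z≤n)
    ... | N , big = suc N , λ n n>N → ℕ.≮⇒≥ λ ω<M →
      ℕ.<⇒≱ (ℕ.≤-<-trans (H^≤Q^ n (2 ℕ.+ M)) (big (index n) (ℕ.≤-trans n>N (ℕ.m≤m+n n K))))
        (ℕ.≤-trans (ℕ.<⇒≤ (proj₂ (proj₂ (log n))))
          (ℕ.^-monoʳ-≤ (H n) {{height-nonZero (r n)}} (ℕ.+-monoʳ-≤ 2 (ℕ.<⇒≤ ω<M))))

    denominators : ∀ M → ∃[ n ] M ℕ.< ↧ₙ r n
    denominators M = suc M , (begin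
      suc M           ≤⟨ ℕ.m≤m+n (suc M) K ⟩
      index (suc M)   ≤⟨ k≤q (index (suc M)) ⟩
      Q (suc M)       ≡⟨ ↧-coprime (p (index (suc M))) (Q (suc M)) {{denominator-nonZero (index (suc M))}}
                           (coprime (index (suc M))) ⟨
      ↧ₙ r (suc M)    ∎)
      where open ℕ.≤-Reasoning

    close : ∀ n → ∃[ s ] upper ∣ ξ -ℝ fromℚ (r n) ∣ s ×
            s ℚ.< (+ 1 ℚ./ H n) {{height-nonZero (r n)}} ^ℚ suc (ω n)
    close n = close-to-centre (p (index n)) (Q n) (Q′ n) 1 (H n) (suc (ω n))
      {{denominator-nonZero (index n)}} {{qq≢0 (index n)}} {{height-nonZero (r n)}}
      (expansion-∈ {ξ} c→ξ (index n)) (begin-strict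
        1 ℕ.* H n ℕ.^ suc (ω n) ≡⟨ ℕ.*-identityˡ (H n ℕ.^ suc (ω n)) ⟩
        H n ℕ.^ suc (ω n)       ≤⟨ proj₁ (proj₂ (log n)) ⟩
        Q′ n                    <⟨ ℕ.m<m*n (Q′ n) (Q n) {{denominator-nonZero (suc (index n))}} (2≤Q n) ⟩
        Q′ n ℕ.* Q n            ≡⟨ ℕ.*-comm (Q′ n) (Q n) ⟩
        Q n ℕ.* Q′ n            ∎)
      where open ℕ.≤-Reasoning

    -- The source of C = 4: the next height is at most A Q′, where A costs one factor H and Q′ <
    -- H^(ω+2), while ω = `suc k` is at least 1.
    3+ω≤4*ω : ∀ k → 4 ℕ.+ k ℕ.≤ 4 ℕ.* suc k
    3+ω≤4*ω k = subst (4 ℕ.+ k ℕ.≤_) (sym (ℕ.*-suc 4 k)) (ℕ.+-monoʳ-≤ 4 (ℕ.m≤n*m k 4))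

    heights : ∀ n → H (suc n) ℕ.≤ H n ℕ.^ (4 ℕ.* ω n)
    heights n = begin
      H (suc n)                    ≤⟨ height≤A*q (suc (index n)) ⟩
      A ℕ.* Q′ n                   ≤⟨ ℕ.*-mono-≤ (ℕ.≤-trans (A≤Q n) (q≤height (index n)))
                                        (ℕ.<⇒≤ (proj₂ (proj₂ (log n)))) ⟩
      H n ℕ.^ (3 ℕ.+ ω n)          ≤⟨ ℕ.^-monoʳ-≤ (H n) {{height-nonZero (r n)}} (3+ω≤4*ω (proj₁ (log n))) ⟩
      H n ℕ.^ (4 ℕ.* ω n)          ∎
      where open ℕ.≤-Reasoning

  strong⇒𝓛 : 𝓛 ξ
  strong⇒𝓛 = 𝓛-intro ξ r ω 4 (ℕ.s≤s ℕ.z≤n) (λ n → ℕ.s≤s ℕ.z≤n) ω→∞ denominators close heights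

-- The diagonal construction

-- Shrinking of the intervals is assumed in the form `narrow`, which is directly the locatedness of
-- the limit.
module NestedIntervals
  (a b : ℕ → ℚ)
  (a-step : ∀ n → a n ℚ.≤ a (suc n)) (b-step : ∀ n → b (suc n) ℚ.≤ b n)
  (a≤b : ∀ n → a n ℚ.≤ b n)
  (narrow : ∀ {p q} → p ℚ.< q → ∃[ n ] (p ℚ.< a n ⊎ b n ℚ.< q))
  where

  private

    a-mono : ∀ {m n} → m ℕ.≤′ n → a m ℚ.≤ a n
    a-mono ℕ.≤′-refl         = ℚ.≤-refl
    a-mono (ℕ.≤′-step {n} m≤n) = ℚ.≤-trans (a-mono m≤n) (a-step n)

    b-anti : ∀ {m n} → m ℕ.≤′ n → b n ℚ.≤ b m
    b-anti ℕ.≤′-refl         = ℚ.≤-refl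
    b-anti (ℕ.≤′-step {n} m≤n) = ℚ.≤-trans (b-step n) (b-anti m≤n)

    a≤b′ : ∀ m n → a m ℚ.≤ b n
    a≤b′ m n = ℚ.≤-trans (a-mono (ℕ.≤⇒≤′ (ℕ.m≤m⊔n m n)))
      (ℚ.≤-trans (a≤b (m ℕ.⊔ n)) (b-anti (ℕ.≤⇒≤′ (ℕ.m≤n⊔m m n))))

    p<p+1 : ∀ p → p ℚ.< p ℚ.+ 1ℚ
    p<p+1 p = subst (ℚ._< p ℚ.+ 1ℚ) (ℚ.+-identityʳ p) (ℚ.+-monoʳ-< p (ℚ.positive⁻¹ 1ℚ))

    p-1<p : ∀ p → p ℚ.- 1ℚ ℚ.< p
    p-1<p p = subst (p ℚ.- 1ℚ ℚ.<_) (ℚ.+-identityʳ p) (ℚ.+-monoʳ-< p (ℚ.negative⁻¹ (ℚ.- 1ℚ)))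

  limit : ℝ
  limit = record
    { lower           = λ q → ∃[ n ] q ℚ.< a n
    ; upper           = λ q → ∃[ n ] b n ℚ.< q
    ; lower-inhabited = a 0 ℚ.- 1ℚ , 0 , p-1<p (a 0)
    ; upper-inhabited = b 0 ℚ.+ 1ℚ , 0 , p<p+1 (b 0)
    ; lower-closed    = λ { p<q (n , q<a) → n , ℚ.<-trans p<q q<a }
    ; upper-closed    = λ { p<q (n , b<p) → n , ℚ.<-trans b<p p<q }
    ; lower-open      = λ { (n , p<a) → let m , p<m , m<a = ℚ.<-dense p<a in m , p<m , n , m<a }
    ; upper-open      = λ { (n , b<q) → let m , b<m , m<q = ℚ.<-dense b<q in m , m<q , n , b<m }
    ; disjoint        = λ { (m , p<a) (n , b<p) → <⇒≱ (ℚ.<-trans b<p p<a) (a≤b′ m n) }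
    ; located         = λ p<q → let n , p<a⊎b<q = narrow p<q in map (n ,_) (n ,_) p<a⊎b<q
    }

  limit-bounds : ∀ n → limit ∈[ a n , b n ]
  limit-bounds n = bounds
    (λ { (m , q<a) → ℚ.<⇒≤ (ℚ.<-≤-trans q<a (a≤b′ m n)) })
    (λ { (m , b<q) → ℚ.<⇒≤ (ℚ.≤-<-trans (a≤b′ n m) b<q) })

coprime-suc : ∀ {a m} → a ℕ.∣ m → Coprime (suc m) a
coprime-suc {a} {m} a∣m {d} (d∣1+m , d∣a) = ℕ.∣1⇒≡1
  (ℕ.∣m+n∣m⇒∣n (subst (d ℕ.∣_) (ℕ.+-comm 1 m) d∣1+m) (ℕ.∣-trans d∣a a∣m))

coprime-^ : ∀ {m a} n → Coprime m a → Coprime m (a ℕ.^ n)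
coprime-^ zero    m⊥a (d∣m , d∣1)  = ℕ.∣1⇒≡1 d∣1
coprime-^ {m} {a} (suc n) m⊥a {d} (d∣m , d∣a^) = coprime-^ n m⊥a
  (d∣m , ℕ.coprime-divisor {d} {a} (λ { (e∣d , e∣a) → m⊥a (ℕ.∣-trans e∣d d∣m , e∣a) }) d∣a^)

-- A positive rational is at least the reciprocal of its denominator.
1/n<ε : ∀ ε n .{{_ : NonZero n}} → 0ℚ ℚ.< ε → ↧ₙ ε ℕ.< n → + 1 ℚ./ n ℚ.< ε
1/n<ε ε@(mkℚ (+ zero) d _)   n 0<ε d<n = ⊥-elim (ℤ.<-irrefl refl (ℚ.drop-*<* 0<ε))
1/n<ε ε@(mkℚ -[1+ _ ] d _)   n 0<ε d<n = ⊥-elim (ℤ.<⇒≱ (ℚ.drop-*<* 0<ε) ℤ.-≤+)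
1/n<ε ε@(mkℚ (+ suc i) d _)  n 0<ε d<n = subst (+ 1 ℚ./ n ℚ.<_) (ℚ.↥p/↧p≡p ε)
  (/-mono-< (+ 1) (+ suc i) n (suc d)
    (subst₂ ℤ._<_ (ℤ.pos-* 1 (suc d)) (ℤ.pos-* (suc i) n)
      (ℤ.+<+ (ℕ.<-≤-trans (subst (ℕ._< n) (sym (ℕ.*-identityˡ (suc d))) d<n) (ℕ.m≤n*m n (suc i))))))

-- A fraction p/q ≠ P/D differs from P/D by at least 1/(q D), which is too much
-- if both are close to the same real: p/q up to 1/(q q′), and P/D with
-- difference in [1/D⁴ , 2/D⁴].
module Comparison (p : ℤ) (P D q q′ : ℕ) (8≤D : 8 ℕ.≤ D) (q≤D² : q ℕ.≤ D ℕ.* D) (D²<q′ : D ℕ.* D ℕ.< q′) where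

  private

    D² D³ F R : ℕ
    D² = D ℕ.* D
    D³ = D ℕ.* D²
    F  = D ℕ.* D³
    R  = suc (P ℕ.* D³)

    instance
      D≢0 : NonZero D
      D≢0 = ℕ.>-nonZero (ℕ.≤-trans (ℕ.s≤s ℕ.z≤n) 8≤D)

    -- Excludes z > 0: as D⁴ < D² q′ and q ≤ D², the right side is below 3 D² q′, and 3 ≤ D.
    too-large₁ : ¬ (q′ ℕ.* D³ ℕ.≤ D ℕ.* D³ ℕ.+ 2 ℕ.* (q ℕ.* q′))
    too-large₁ le = ℕ.<⇒≱ (begin-strict
      D ℕ.* D³ ℕ.+ 2 ℕ.* (q ℕ.* q′)    ≡⟨ cong (ℕ._+ 2 ℕ.* (q ℕ.* q′)) (ring₁ D) ⟩
      D² ℕ.* D² ℕ.+ 2 ℕ.* (q ℕ.* q′)   <⟨ ℕ.+-mono-<-≤ (ℕ.*-monoʳ-< D² {{ℕ.m*n≢0 D D}} D²<q′)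
                                            (ℕ.*-monoʳ-≤ 2 (ℕ.*-monoˡ-≤ q′ q≤D²)) ⟩
      D² ℕ.* q′ ℕ.+ 2 ℕ.* (D² ℕ.* q′)  ≡⟨⟩
      3 ℕ.* (D² ℕ.* q′)                ≤⟨ ℕ.*-monoˡ-≤ (D² ℕ.* q′) (ℕ.≤-trans (ℕ.s≤s (ℕ.s≤s (ℕ.s≤s ℕ.z≤n))) 8≤D) ⟩
      D ℕ.* (D² ℕ.* q′)                ≡⟨ ring₂ D D² q′ ⟩
      q′ ℕ.* D³                        ∎) le
      where
      open ℕ.≤-Reasoning
      ring₁ : ∀ D → D ℕ.* (D ℕ.* (D ℕ.* D)) ≡ D ℕ.* D ℕ.* (D ℕ.* D)
      ring₁ = ℕSolver.solve-∀
      ring₂ : ∀ D D² q → D ℕ.* (D² ℕ.* q) ≡ q ℕ.* (D ℕ.* D²)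
      ring₂ = ℕSolver.solve-∀

    -- Excludes z < 0: cancelling D³ would leave q′ ≤ D, although D ≤ D² < q′.
    too-large₂ : ¬ (q′ ℕ.* D³ ℕ.≤ D ℕ.* D³)
    too-large₂ le = ℕ.<⇒≱ (ℕ.≤-<-trans (ℕ.m≤m*n D D) D²<q′)
      (ℕ.*-cancelʳ-≤ q′ D D³ {{ℕ.m*n≢0 D D² {{D≢0}} {{ℕ.m*n≢0 D D}}}} le)

    pos-F : + F ≡ + D ℤ.* + D³
    pos-F = ℤ.pos-* D D³

    pos-qq : + (q ℕ.* q′) ≡ + q ℤ.* + q′
    pos-qq = ℤ.pos-* q q′

    -- The numerator of p/q - P/D over q D; `upper-z` and `lower-z` are the two overlap inequalities
    -- solved for it.
    z : ℤ
    z = p ℤ.* + D ℤ.- + P ℤ.* + q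

    upper-z : (p ℤ.* + q′ ℤ.- + 1) ℤ.* + F ℤ.≤ + suc R ℤ.* + (q ℕ.* q′) →
              z ℤ.* + (q′ ℕ.* D³) ℤ.≤ + (D ℕ.* D³ ℕ.+ 2 ℕ.* (q ℕ.* q′))
    upper-z le = ℤ.0≤i-j⇒j≤i (subst (+ 0 ℤ.≤_)
      (eq p (+ P) (+ D) (+ D³) (+ q) (+ q′) pos-F (cong (ℤ._+_ (+ 2)) (ℤ.pos-* P D³)) pos-qq (ℤ.pos-* q′ D³)
        (cong₂ ℤ._+_ (ℤ.pos-* D D³) (trans (ℤ.pos-* 2 (q ℕ.* q′)) (cong (+ 2 ℤ.*_) pos-qq))))
      (ℤ.i≤j⇒0≤j-i le))
      where
      ring : ∀ p P D D³ q q′ →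
        (+ 2 ℤ.+ P ℤ.* D³) ℤ.* (q ℤ.* q′) ℤ.- (p ℤ.* q′ ℤ.- + 1) ℤ.* (D ℤ.* D³) ≡
        (D ℤ.* D³ ℤ.+ + 2 ℤ.* (q ℤ.* q′)) ℤ.- (p ℤ.* D ℤ.- P ℤ.* q) ℤ.* (q′ ℤ.* D³)
      ring = ℤSolver.solve-∀
      eq : ∀ p P D D³ q q′ {F 1+R qq q′D³ s} → F ≡ D ℤ.* D³ → 1+R ≡ + 2 ℤ.+ P ℤ.* D³ → qq ≡ q ℤ.* q′ →
        q′D³ ≡ q′ ℤ.* D³ → s ≡ D ℤ.* D³ ℤ.+ + 2 ℤ.* (q ℤ.* q′) →
        1+R ℤ.* qq ℤ.- (p ℤ.* q′ ℤ.- + 1) ℤ.* F ≡ s ℤ.- (p ℤ.* D ℤ.- P ℤ.* q) ℤ.* q′D³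
      eq p P D D³ q q′ refl refl refl refl refl = ring p P D D³ q q′

    lower-z : + R ℤ.* + (q ℕ.* q′) ℤ.≤ (p ℤ.* + q′ ℤ.+ + 1) ℤ.* + F →
              + (q ℕ.* q′) ℤ.- z ℤ.* + (q′ ℕ.* D³) ℤ.≤ + (D ℕ.* D³)
    lower-z le = ℤ.0≤i-j⇒j≤i (subst (+ 0 ℤ.≤_)
      (eq p (+ P) (+ D) (+ D³) (+ q) (+ q′) pos-F (cong (ℤ._+_ (+ 1)) (ℤ.pos-* P D³)) pos-qq (ℤ.pos-* q′ D³))
      (ℤ.i≤j⇒0≤j-i le))
      where
      ring : ∀ p P D D³ q q′ →
        (p ℤ.* q′ ℤ.+ + 1) ℤ.* (D ℤ.* D³) ℤ.- (+ 1 ℤ.+ P ℤ.* D³) ℤ.* (q ℤ.* q′) ≡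
        (D ℤ.* D³) ℤ.- (q ℤ.* q′ ℤ.- (p ℤ.* D ℤ.- P ℤ.* q) ℤ.* (q′ ℤ.* D³))
      ring = ℤSolver.solve-∀
      eq : ∀ p P D D³ q q′ {F R qq q′D³} → F ≡ D ℤ.* D³ → R ≡ + 1 ℤ.+ P ℤ.* D³ → qq ≡ q ℤ.* q′ →
        q′D³ ≡ q′ ℤ.* D³ →
        (p ℤ.* q′ ℤ.+ + 1) ℤ.* F ℤ.- R ℤ.* qq ≡ F ℤ.- (qq ℤ.- (p ℤ.* D ℤ.- P ℤ.* q) ℤ.* q′D³)
      eq p P D D³ q q′ refl refl refl refl = ring p P D D³ q q′

    pos-impossible : ∀ n → ¬ (+ suc n ℤ.* + (q′ ℕ.* D³) ℤ.≤ + (D ℕ.* D³ ℕ.+ 2 ℕ.* (q ℕ.* q′)))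
    pos-impossible n le = too-large₁ (ℕ.≤-trans (ℕ.m≤n*m (q′ ℕ.* D³) (suc n))
      (ℤ.drop‿+≤+ (subst (ℤ._≤ + (D ℕ.* D³ ℕ.+ 2 ℕ.* (q ℕ.* q′))) (sym (ℤ.pos-* (suc n) (q′ ℕ.* D³))) le)))

    neg-impossible : ∀ n → ¬ (+ (q ℕ.* q′) ℤ.- -[1+ n ] ℤ.* + (q′ ℕ.* D³) ℤ.≤ + (D ℕ.* D³))
    neg-impossible n le = too-large₂ (ℕ.≤-trans (ℕ.m≤n*m (q′ ℕ.* D³) (suc n))
      (ℕ.≤-trans (ℕ.m≤n+m (suc n ℕ.* (q′ ℕ.* D³)) (q ℕ.* q′)) (ℤ.drop‿+≤+ (subst (ℤ._≤ + (D ℕ.* D³)) eq le))))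
      where
      eq : + (q ℕ.* q′) ℤ.- -[1+ n ] ℤ.* + (q′ ℕ.* D³) ≡ + (q ℕ.* q′ ℕ.+ suc n ℕ.* (q′ ℕ.* D³))
      eq = cong (ℤ._+_ (+ (q ℕ.* q′))) (trans (ℤ.neg-distribˡ-* -[1+ n ] (+ (q′ ℕ.* D³)))
        (sym (ℤ.pos-* (suc n) (q′ ℕ.* D³))))

  cross≡ : (p ℤ.* + q′ ℤ.- + 1) ℤ.* + F ℤ.≤ + suc R ℤ.* + (q ℕ.* q′) →
           + R ℤ.* + (q ℕ.* q′) ℤ.≤ (p ℤ.* + q′ ℤ.+ + 1) ℤ.* + F →
           p ℤ.* + D ≡ + P ℤ.* + q
  cross≡ le₁ le₂ = ℤ.i-j≡0⇒i≡j (p ℤ.* + D) (+ P ℤ.* + q) (go z (upper-z le₁) (lower-z le₂))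
    where
    go : ∀ z → z ℤ.* + (q′ ℕ.* D³) ℤ.≤ + (D ℕ.* D³ ℕ.+ 2 ℕ.* (q ℕ.* q′)) →
         + (q ℕ.* q′) ℤ.- z ℤ.* + (q′ ℕ.* D³) ℤ.≤ + (D ℕ.* D³) → z ≡ + 0
    go (+ zero)  _   _   = refl
    go (+ suc n) le₁ _   = ⊥-elim (pos-impossible n le₁)
    go -[1+ n ]  _   le₂ = ⊥-elim (neg-impossible n le₂)

  -- With p/q equal to P/D, the hypothesis says P/D + 1/D⁴ ≤ P/D + 1/(D q′).
  q′≤D³ : p ≡ + P → q ≡ D → + R ℤ.* + (q ℕ.* q′) ℤ.≤ (p ℤ.* + q′ ℤ.+ + 1) ℤ.* + F → q′ ℕ.≤ D³
  q′≤D³ refl refl le = ℕ.*-cancelˡ-≤ D (ℕ.+-cancelˡ-≤ (P ℕ.* q′ ℕ.* F) (D ℕ.* q′) (D ℕ.* D³)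
    (subst₂ ℕ._≤_ (ring₁ P q′ D D³) (ring₂ P q′ D D³) (ℤ.drop‿+≤+
      (subst₂ ℤ._≤_ (sym (ℤ.pos-* R (q ℕ.* q′)))
        (trans (cong (λ x → (x ℤ.+ + 1) ℤ.* + F) (sym (ℤ.pos-* P q′))) (sym (ℤ.pos-* (P ℕ.* q′ ℕ.+ 1) F))) le))))
    where
    ring₁ : ∀ P q′ D D³ → suc (P ℕ.* D³) ℕ.* (D ℕ.* q′) ≡ P ℕ.* q′ ℕ.* (D ℕ.* D³) ℕ.+ D ℕ.* q′
    ring₁ = ℕSolver.solve-∀
    ring₂ : ∀ P q′ D D³ → (P ℕ.* q′ ℕ.+ 1) ℕ.* (D ℕ.* D³) ≡ P ℕ.* q′ ℕ.* (D ℕ.* D³) ℕ.+ D ℕ.* D³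
    ring₂ = ℕSolver.solve-∀

-- One step from P/D, through R/F = P/D + 1/D⁴, to next c / (F t) = R/F + (1+c)/(F t).
module Step (D P e : ℕ) (8≤D : 8 ℕ.≤ D) (P<D : P ℕ.< D) where

  D³ F t R : ℕ
  D³ = D ℕ.* (D ℕ.* D)
  F  = D ℕ.* D³
  t  = F ℕ.^ (3 ℕ.+ e)
  R  = suc (P ℕ.* D³)

  next : ℕ → ℕ
  next c = suc (R ℕ.* t ℕ.+ c)

  instance
    D≢0 : NonZero D
    D≢0 = ℕ.>-nonZero (ℕ.≤-trans (ℕ.s≤s ℕ.z≤n) 8≤D)
    D³≢0 : NonZero D³
    D³≢0 = ℕ.m*n≢0 D (D ℕ.* D) {{D≢0}} {{ℕ.m*n≢0 D D}}
    F≢0 : NonZero F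
    F≢0 = ℕ.m*n≢0 D D³
    t≢0 : NonZero t
    t≢0 = ℕ.m^n≢0 F (3 ℕ.+ e)
    Ft≢0 : NonZero (F ℕ.* t)
    Ft≢0 = ℕ.m*n≢0 F t

  open ℕ.≤-Reasoning

  D≤D³ : D ℕ.≤ D³
  D≤D³ = ℕ.m≤m*n D (D ℕ.* D) {{ℕ.m*n≢0 D D}}

  -- The limit stays within (D + 2)/(F t) of R/F, so this makes it closer than 1/t, a power of 1/F.
  -- It also keeps the next interval inside the one from R/F to (R + 1)/F.
  D+2<F : D ℕ.+ 2 ℕ.< F
  D+2<F = begin-strict
    D ℕ.+ 2   <⟨ ℕ.+-monoʳ-< D (ℕ.<-≤-trans (ℕ.s≤s (ℕ.s≤s (ℕ.s≤s ℕ.z≤n))) 8≤D) ⟩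
    D ℕ.+ D   ≡⟨ cong (D ℕ.+_) (ℕ.+-identityʳ D) ⟨
    2 ℕ.* D   ≤⟨ ℕ.*-mono-≤ (ℕ.≤-trans (ℕ.s≤s (ℕ.s≤s ℕ.z≤n)) 8≤D) D≤D³ ⟩
    F         ∎

  F≤t : F ℕ.≤ t
  F≤t = ℕ.m≤m*n F (F ℕ.^ (2 ℕ.+ e)) {{ℕ.m^n≢0 F (2 ℕ.+ e)}}

  1+R≤[1+P]D³ : suc R ℕ.≤ suc P ℕ.* D³
  1+R≤[1+P]D³ = ℕ.+-monoˡ-≤ (P ℕ.* D³)
    (ℕ.≤-trans (ℕ.≤-trans (ℕ.s≤s (ℕ.s≤s ℕ.z≤n)) 8≤D) D≤D³)

  1+R≤F : suc R ℕ.≤ F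
  1+R≤F = ℕ.≤-trans 1+R≤[1+P]D³ (ℕ.*-monoˡ-≤ D³ P<D)

  -- With `[1+R]/F≤[1+P]/D`, `R/F≤P′/Ft` and `[1+P′]/Ft≤[1+R]/F`, this nests the intervals from
  -- numerator to numerator plus one over D, F and F t.
  P/D≤R/F : + P ℚ./ D ℚ.≤ + R ℚ./ F
  P/D≤R/F = frac-≤ P R D F (begin
    P ℕ.* F          ≡⟨ ring P D D³ ⟩
    P ℕ.* D³ ℕ.* D   ≤⟨ ℕ.*-monoˡ-≤ D (ℕ.n≤1+n (P ℕ.* D³)) ⟩
    R ℕ.* D          ∎)
    where
    ring : ∀ P D D³ → P ℕ.* (D ℕ.* D³) ≡ P ℕ.* D³ ℕ.* D
    ring = ℕSolver.solve-∀

  [1+R]/F≤[1+P]/D : + suc R ℚ./ F ℚ.≤ + suc P ℚ./ D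
  [1+R]/F≤[1+P]/D = frac-≤ (suc R) (suc P) F D (begin
    suc R ℕ.* D            ≤⟨ ℕ.*-monoˡ-≤ D 1+R≤[1+P]D³ ⟩
    suc P ℕ.* D³ ℕ.* D     ≡⟨ ring (suc P) D D³ ⟩
    suc P ℕ.* F            ∎)
    where
    ring : ∀ P D D³ → P ℕ.* D³ ℕ.* D ≡ P ℕ.* (D ℕ.* D³)
    ring = ℕSolver.solve-∀

  D∣D³ : D ℕ.∣ D³
  D∣D³ = ℕ.m∣m*n (D ℕ.* D)

  D∣t : D ℕ.∣ t
  D∣t = ℕ.∣-trans (ℕ.m∣m*n D³) (ℕ.m∣m*n (F ℕ.^ (2 ℕ.+ e)))

  F≡D^4 : F ≡ D ℕ.^ 4
  F≡D^4 = ring D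
    where
    ring : ∀ D → D ℕ.* (D ℕ.* (D ℕ.* D)) ≡ D ℕ.* (D ℕ.* (D ℕ.* (D ℕ.* 1)))
    ring = ℕSolver.solve-∀

  Coprime-F : ∀ {m} → Coprime m D → Coprime m F
  Coprime-F {m} m⊥D = subst (Coprime m) (sym F≡D^4) (coprime-^ 4 m⊥D)

  -- R is one more than a multiple of D, and F is a power of D.
  R⊥F : Coprime R F
  R⊥F = Coprime-F (coprime-suc (ℕ.∣n⇒∣m*n P D∣D³))

  module Next (c : ℕ) (c≤D : c ℕ.≤ D) where

    P′ : ℕ
    P′ = next c

    1+P′≤Rt+[D+2] : suc P′ ℕ.≤ R ℕ.* t ℕ.+ (D ℕ.+ 2)
    1+P′≤Rt+[D+2] = begin
      2 ℕ.+ (R ℕ.* t ℕ.+ c)     ≡⟨ ring (R ℕ.* t) c ⟩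
      R ℕ.* t ℕ.+ (c ℕ.+ 2)     ≤⟨ ℕ.+-monoʳ-≤ (R ℕ.* t) (ℕ.+-monoˡ-≤ 2 c≤D) ⟩
      R ℕ.* t ℕ.+ (D ℕ.+ 2)     ∎
      where
      ring : ∀ x c → 2 ℕ.+ (x ℕ.+ c) ≡ x ℕ.+ (c ℕ.+ 2)
      ring = ℕSolver.solve-∀

    1+P′≤[1+R]t : suc P′ ℕ.≤ suc R ℕ.* t
    1+P′≤[1+R]t = begin
      suc P′                    ≤⟨ 1+P′≤Rt+[D+2] ⟩
      R ℕ.* t ℕ.+ (D ℕ.+ 2)     ≤⟨ ℕ.+-monoʳ-≤ (R ℕ.* t) (ℕ.≤-trans (ℕ.<⇒≤ D+2<F) F≤t) ⟩
      R ℕ.* t ℕ.+ t             ≡⟨ ℕ.+-comm (R ℕ.* t) t ⟩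
      suc R ℕ.* t               ∎

    P′<Ft : P′ ℕ.< F ℕ.* t
    P′<Ft = ℕ.≤-trans 1+P′≤[1+R]t (ℕ.*-monoˡ-≤ t 1+R≤F)

    Rt≤P′ : R ℕ.* t ℕ.≤ P′
    Rt≤P′ = ℕ.≤-trans (ℕ.m≤m+n (R ℕ.* t) c) (ℕ.n≤1+n _)

    R/F≤P′/Ft : + R ℚ./ F ℚ.≤ + P′ ℚ./ (F ℕ.* t)
    R/F≤P′/Ft = frac-≤ R P′ F (F ℕ.* t) (begin
      R ℕ.* (F ℕ.* t)  ≡⟨ ring R F t ⟩
      R ℕ.* t ℕ.* F    ≤⟨ ℕ.*-monoˡ-≤ F Rt≤P′ ⟩
      P′ ℕ.* F         ∎)
      where
      ring : ∀ R F t → R ℕ.* (F ℕ.* t) ≡ R ℕ.* t ℕ.* F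
      ring = ℕSolver.solve-∀

    [1+P′]/Ft≤[1+R]/F : + suc P′ ℚ./ (F ℕ.* t) ℚ.≤ + suc R ℚ./ F
    [1+P′]/Ft≤[1+R]/F = frac-≤ (suc P′) (suc R) (F ℕ.* t) F (begin
      suc P′ ℕ.* F           ≤⟨ ℕ.*-monoˡ-≤ F 1+P′≤[1+R]t ⟩
      suc R ℕ.* t ℕ.* F      ≡⟨ ring (suc R) F t ⟩
      suc R ℕ.* (F ℕ.* t)    ∎)
      where
      ring : ∀ R F t → R ℕ.* t ℕ.* F ≡ R ℕ.* (F ℕ.* t)
      ring = ℕSolver.solve-∀

    ball-lo : (+ R ℤ.* + t ℤ.- + (D ℕ.+ 2)) ℚ./ (F ℕ.* t) ℚ.≤ + P′ ℚ./ (F ℕ.* t)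
    ball-lo = /-mono-≤ (+ R ℤ.* + t ℤ.- + (D ℕ.+ 2)) (+ P′) (F ℕ.* t) (F ℕ.* t)
      (ℤ.*-monoʳ-≤-nonNeg (+ (F ℕ.* t)) (ℤ.≤-trans
        (ℤ.i≤j⇒i-k≤j (+ (D ℕ.+ 2)) ℤ.≤-refl)
        (subst (ℤ._≤ + P′) (ℤ.pos-* R t) (ℤ.+≤+ Rt≤P′))))

    ball-hi : + suc P′ ℚ./ (F ℕ.* t) ℚ.≤ (+ R ℤ.* + t ℤ.+ + (D ℕ.+ 2)) ℚ./ (F ℕ.* t)
    ball-hi = /-mono-≤ (+ suc P′) (+ R ℤ.* + t ℤ.+ + (D ℕ.+ 2)) (F ℕ.* t) (F ℕ.* t)
      (ℤ.*-monoʳ-≤-nonNeg (+ (F ℕ.* t))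
        (subst (λ z → + suc P′ ℤ.≤ z ℤ.+ + (D ℕ.+ 2)) (ℤ.pos-* R t) (ℤ.+≤+ 1+P′≤Rt+[D+2])))

    -- D divides both t and c, so P′ is one more than a multiple of D, while `F * t` is F^(4+e) by
    -- computation. Keeping this fraction reduced is why digits are multiples of D.
    P′⊥Ft : D ℕ.∣ c → Coprime P′ (F ℕ.* t)
    P′⊥Ft D∣c = coprime-^ (4 ℕ.+ e)
      (Coprime-F (coprime-suc (ℕ.∣m∣n⇒∣m+n (ℕ.∣n⇒∣m*n R D∣t) D∣c)))

-- The source of C = 8 with ω = 2 + n: the next height is the fourth power of F^(4+n), and 16 + 4n ≤
-- 8 (2 + n).
^-exponent-bound : ∀ n F .{{_ : NonZero F}} → (F ℕ.^ (4 ℕ.+ n)) ℕ.^ 4 ℕ.≤ F ℕ.^ (8 ℕ.* (2 ℕ.+ n))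
^-exponent-bound n F = begin
  (F ℕ.^ (4 ℕ.+ n)) ℕ.^ 4            ≡⟨ ℕ.^-*-assoc F (4 ℕ.+ n) 4 ⟩
  F ℕ.^ ((4 ℕ.+ n) ℕ.* 4)            ≤⟨ ℕ.^-monoʳ-≤ F (ℕ.m≤m+n ((4 ℕ.+ n) ℕ.* 4) (4 ℕ.* n)) ⟩
  F ℕ.^ ((4 ℕ.+ n) ℕ.* 4 ℕ.+ 4 ℕ.* n) ≡⟨ cong (F ℕ.^_) (ring n) ⟩
  F ℕ.^ (8 ℕ.* (2 ℕ.+ n))            ∎
  where
  open ℕ.≤-Reasoning
  ring : ∀ n → (4 ℕ.+ n) ℕ.* 4 ℕ.+ 4 ℕ.* n ≡ 8 ℕ.* (2 ℕ.+ n)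
  ring = ℕSolver.solve-∀

record Stage : Set where
  field
    D P : ℕ
    8≤D : 8 ℕ.≤ D
    P<D : P ℕ.< D

module _ (x : ℝ) (s : Stage) (e : ℕ) where

  open Stage s
  open Step D P e 8≤D P<D

  record Digit : Set where
    field
      c      : ℕ
      c≤D    : c ℕ.≤ D
      D∣c    : D ℕ.∣ c
      -- x lies beyond one end of the interval left to the limit by the digit c.
      avoids : lower x (+ suc (next c) ℚ./ (F ℕ.* t)) ⊎ upper x (+ next c ℚ./ (F ℕ.* t))

  opaque

    -- Leaves a gap between the intervals belonging to the digits 0 and D; locating x in that gap
    -- shows which of the two intervals it misses.
    next-0<next-D : suc (next 0) ℕ.< next D
    next-0<next-D = ℕ.s≤s (ℕ.≤-trans (ℕ.≤-reflexive (ring (R ℕ.* t)))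
      (ℕ.+-monoʳ-≤ (R ℕ.* t) (ℕ.≤-trans (ℕ.s≤s (ℕ.s≤s ℕ.z≤n)) 8≤D)))
      where
      ring : ∀ y → suc (suc (y ℕ.+ 0)) ≡ y ℕ.+ 2
      ring = ℕSolver.solve-∀

    digit : Digit
    digit = [ (λ u<x → record { c = 0 ; c≤D = ℕ.z≤n ; D∣c = D ℕ.∣0 ; avoids = inj₁ u<x })
            , (λ x<v → record { c = D ; c≤D = ℕ.≤-refl ; D∣c = ℕ.∣-refl ; avoids = inj₂ x<v })
            ]′ (located x (frac-< (suc (next 0)) (next D) (F ℕ.* t) (F ℕ.* t)
                           (ℕ.*-monoˡ-< (F ℕ.* t) next-0<next-D)))

module Diagonal (f : ℕ → ℝ) where

  nextStage : ℕ → Stage → Stage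
  nextStage n s = record
    { D = F ℕ.* t ; P = P′ ; P<D = P′<Ft
    ; 8≤D = ℕ.≤-trans 8≤D (ℕ.≤-trans (ℕ.m≤m*n D D³) (ℕ.m≤m*n F t))
    }
    where
    open Stage s
    open Digit (digit (f n) s n)
    open Step D P n 8≤D P<D
    open Next c c≤D

  stage : ℕ → Stage
  stage zero    = record { D = 8 ; P = 1 ; 8≤D = ℕ.≤-refl ; P<D = ℕ.s≤s (ℕ.s≤s ℕ.z≤n) }
  stage (suc n) = nextStage n (stage n)

  module At (n : ℕ) where
    open Stage (stage n) public
    open Digit (digit (f n) (stage n) n) public
    open Step D P n 8≤D P<D public
    open Next c c≤D public

  open At using (D; P; R; F; t; D≢0; F≢0; t≢0; Ft≢0)

  n<D : ∀ n → n ℕ.< D n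
  n<D zero    = ℕ.s≤s ℕ.z≤n
  n<D (suc n) = begin-strict
    suc n        ≤⟨ n<D n ⟩
    D n          <⟨ ℕ.≤-<-trans (ℕ.m≤m+n (D n) 2) (At.D+2<F n) ⟩
    F n          ≤⟨ ℕ.m≤m*n (F n) (t n) {{t≢0 n}} ⟩
    F n ℕ.* t n  ∎
    where open ℕ.≤-Reasoning

  opaque

    a b : ℕ → ℚ
    a n = (+ P n ℚ./ D n) {{D≢0 n}}
    b n = (+ suc (P n) ℚ./ D n) {{D≢0 n}}

    -- The interval has length 1/D, so if a ≤ p its right end is below p + (q - p).
    narrow-at : ∀ n {p q} → (+ 1 ℚ./ D n) {{D≢0 n}} ℚ.< q ℚ.- p → p ℚ.< a n ⊎ b n ℚ.< q
    narrow-at n {p} {q} 1/D<q-p = [ inj₁ , (λ a≤p → inj₂ (b<q a≤p)) ]′ (<⊎≥ p (a n))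
      where
      open ℚ.≤-Reasoning
      open +-*-Solver
      cancel : ∀ p q → p ℚ.+ (q ℚ.- p) ≡ q
      cancel = solve 2 (λ p q → p :+ (q :- p) := q) refl
      b<q : a n ℚ.≤ p → b n ℚ.< q
      b<q a≤p = begin-strict
        b n                                  ≡⟨ cong (λ i → (i ℚ./ D n) {{D≢0 n}}) (ℤ.+-comm (+ 1) (+ P n)) ⟩
        ((+ P n ℤ.+ + 1) ℚ./ D n) {{D≢0 n}}  ≡⟨ /-+-same (+ P n) (+ 1) (D n) {{D≢0 n}} ⟨
        a n ℚ.+ (+ 1 ℚ./ D n) {{D≢0 n}}      <⟨ ℚ.+-mono-≤-< a≤p 1/D<q-p ⟩
        p ℚ.+ (q ℚ.- p)                      ≡⟨ cancel p q ⟩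
        q                                    ∎

    a-step : ∀ n → a n ℚ.≤ a (suc n)
    a-step n = ℚ.≤-trans (At.P/D≤R/F n) (At.R/F≤P′/Ft n)

    b-step : ∀ n → b (suc n) ℚ.≤ b n
    b-step n = ℚ.≤-trans (At.[1+P′]/Ft≤[1+R]/F n) (At.[1+R]/F≤[1+P]/D n)

    a≤b : ∀ n → a n ℚ.≤ b n
    a≤b n = frac-≤ (P n) (suc (P n)) (D n) (D n) {{D≢0 n}} {{D≢0 n}} (ℕ.*-monoˡ-≤ (D n) (ℕ.n≤1+n (P n)))

  opaque

    narrow : ∀ {p q} → p ℚ.< q → ∃[ n ] (p ℚ.< a n ⊎ b n ℚ.< q)
    -- The denominator of q - p serves as the index: D n > n then makes 1/D n smaller than q - p.
    narrow {p} {q} p<q = go (↧ₙ (q ℚ.- p)) ℕ.≤-refl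
      where
      0<q-p : 0ℚ ℚ.< q ℚ.- p
      0<q-p = subst (ℚ._< q ℚ.- p) (ℚ.+-inverseʳ p) (ℚ.+-monoˡ-< (ℚ.- p) p<q)
      go : ∀ n → ↧ₙ (q ℚ.- p) ℕ.≤ n → ∃[ n ] (p ℚ.< a n ⊎ b n ℚ.< q)
      go n d≤n = n , narrow-at n (1/n<ε (q ℚ.- p) (D n) {{D≢0 n}} 0<q-p (ℕ.≤-<-trans d≤n (n<D n)))

  opaque

    ξ : ℝ
    ξ = NestedIntervals.limit a b a-step b-step a≤b narrow

    ξ∈ : ∀ n → ξ ∈[ a n , b n ]
    ξ∈ = NestedIntervals.limit-bounds a b a-step b-step a≤b narrow

  opaque
    unfolding a

    ξ∈R : ∀ n → ξ ∈[ (+ R n ℚ./ F n) {{F≢0 n}} , (+ suc (R n) ℚ./ F n) {{F≢0 n}} ]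
    ξ∈R n = ∈-weaken (At.R/F≤P′/Ft n) (At.[1+P′]/Ft≤[1+R]/F n) (ξ∈ (suc n))

    ξ∈ball : ∀ n → ξ ∈[ ((+ R n ℤ.* + t n ℤ.- + (D n ℕ.+ 2)) ℚ./ (F n ℕ.* t n)) {{Ft≢0 n}}
                      , ((+ R n ℤ.* + t n ℤ.+ + (D n ℕ.+ 2)) ℚ./ (F n ℕ.* t n)) {{Ft≢0 n}} ]
    ξ∈ball n = ∈-weaken (At.ball-lo n) (At.ball-hi n) (ξ∈ (suc n))

    -- The interval of stage n + 1 contains ξ and has f n beyond one end; openness of the cut of f n
    -- supplies a rational separating them.
    ξ≄f : ∀ n → ¬ (ξ ≃ f n)
    ξ≄f n (ξ≤f , f≤ξ) =
      [ (λ u<f → let q , u<q , q<f = lower-open (f n) u<f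
                 in f≤ξ (q , <⇒upper (ξ∈ (suc n)) u<q , q<f))
      , (λ f<v → let q , q<v , f<q = upper-open (f n) f<v
                 in ξ≤f (q , f<q , <⇒lower (ξ∈ (suc n)) q<v))
      ]′ (At.avoids n)

  -- Membership of `ξ` in `𝓛`

  opaque

    r : ℕ → ℚ
    r n = (+ R n ℚ./ F n) {{F≢0 n}}

    ↧-r : ∀ n → ↧ₙ r n ≡ F n
    ↧-r n = ↧-coprime (+ R n) (F n) {{F≢0 n}} (At.R⊥F n)

    height-r : ∀ n → height (r n) ≡ F n
    height-r n = trans (height-coprime (+ R n) (F n) {{F≢0 n}} (At.R⊥F n))
      (ℕ.m≤n⇒m⊔n≡n (ℕ.<⇒≤ (At.1+R≤F n)))

    r-close : ∀ n → ∃[ q ] upper ∣ ξ -ℝ fromℚ (r n) ∣ q ×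
              q ℚ.< (+ 1 ℚ./ height (r n)) {{height-nonZero (r n)}} ^ℚ (3 ℕ.+ n)
    r-close n = close-to-centre (+ R n) (F n) (t n) (D n ℕ.+ 2) (height (r n)) (3 ℕ.+ n)
      {{F≢0 n}} {{Ft≢0 n}} {{height-nonZero (r n)}} (ξ∈ball n)
      (subst (λ h → (D n ℕ.+ 2) ℕ.* h ℕ.^ (3 ℕ.+ n) ℕ.< F n ℕ.* t n) (sym (height-r n))
        -- With height F, the power F^(3+n) is t itself, so the claim is D + 2 < F multiplied by t.
        (ℕ.*-monoˡ-< (t n) {{t≢0 n}} (At.D+2<F n)))

  r-heights : ∀ n → height (r (suc n)) ℕ.≤ height (r n) ℕ.^ (8 ℕ.* (2 ℕ.+ n))
  r-heights n = subst₂ (λ h h′ → h′ ℕ.≤ h ℕ.^ (8 ℕ.* (2 ℕ.+ n))) (sym (height-r n)) (sym (height-r (suc n)))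
    (subst (ℕ._≤ F n ℕ.^ (8 ℕ.* (2 ℕ.+ n))) (sym (At.F≡D^4 (suc n))) (^-exponent-bound n (F n) {{F≢0 n}}))

  ξ∈𝓛 : 𝓛 ξ
  ξ∈𝓛 = 𝓛-intro ξ r (2 ℕ.+_) 8 (ℕ.s≤s ℕ.z≤n) (λ n → ℕ.s≤s ℕ.z≤n)
    (λ M → M , λ n M≤n → ℕ.≤-trans M≤n (ℕ.m≤n+m n 2))
    (λ M → M , subst (M ℕ.<_) (sym (↧-r M)) (ℕ.<-trans (n<D M) (ℕ.≤-<-trans (ℕ.m≤m+n (D M) 2) (At.D+2<F M))))
    r-close r-heights

  -- Failure of the strong Liouville condition

  P⊥D : ∀ n → Coprime (P (suc n)) (D (suc n))
  P⊥D n = At.P′⊥Ft n (At.D∣c n)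

  module _ (c : ContinuedFraction) (c→ξ : c IsExpansionOf ξ) where

    open ContinuedFraction c renaming (numerator to p; denominator to q)
    open Convergents c

    convergent-equation : ∀ n k → q k ℕ.≤ D n ℕ.* D n → D n ℕ.* D n ℕ.< q (suc k) →
      p k ℤ.* + D n ≡ + P n ℤ.* + q k ×
      + R n ℤ.* + (q k ℕ.* q (suc k)) ℤ.≤ (p k ℤ.* + q (suc k) ℤ.+ + 1) ℤ.* + F n
    convergent-equation n k qₖ≤D² D²<qₖ₊₁ =
      Comparison.cross≡ (p k) (P n) (D n) (q k) (q (suc k)) (At.8≤D n) qₖ≤D² D²<qₖ₊₁ le₁ le₂ , le₂
      where
      le₁ : (p k ℤ.* + q (suc k) ℤ.- + 1) ℤ.* + F n ℤ.≤ + suc (R n) ℤ.* + (q k ℕ.* q (suc k))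
      le₁ = /-cancel-≤ (p k ℤ.* + q (suc k) ℤ.- + 1) (+ suc (R n)) (q k ℕ.* q (suc k)) (F n)
        {{qq≢0 k}} {{F≢0 n}} (∈-overlap (expansion-∈ {ξ} c→ξ k) (ξ∈R n))

      le₂ : + R n ℤ.* + (q k ℕ.* q (suc k)) ℤ.≤ (p k ℤ.* + q (suc k) ℤ.+ + 1) ℤ.* + F n
      le₂ = /-cancel-≤ (+ R n) (p k ℤ.* + q (suc k) ℤ.+ + 1) (F n) (q k ℕ.* q (suc k))
        {{F≢0 n}} {{qq≢0 k}} (∈-overlap (ξ∈R n) (expansion-∈ {ξ} c→ξ k))

    -- The index k is the one with q k ≤ D² < q (k+1). `Comparison` identifies the convergent there
    -- with P/D, and since both fractions are reduced, numerators and denominators agree.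
    D-is-denominator : ∀ n → Coprime (P n) (D n) → ∃[ k ] q k ≡ D n × q (suc k) ℕ.≤ D n ℕ.^ 3
    D-is-denominator n P⊥D = go (bracket q {D n ℕ.* D n}
        (ℕ.>-nonZero⁻¹ (D n ℕ.* D n) {{ℕ.m*n≢0 (D n) (D n) {{D≢0 n}} {{D≢0 n}}}})
        (suc (D n ℕ.* D n)) (k≤q (suc (D n ℕ.* D n))))
      where
      go : ∃[ k ] (q k ℕ.≤ D n ℕ.* D n × D n ℕ.* D n ℕ.< q (suc k)) → ∃[ k ] q k ≡ D n × q (suc k) ℕ.≤ D n ℕ.^ 3
      go (k , qₖ≤D² , D²<qₖ₊₁) = k , q≡D
        , subst (q (suc k) ℕ.≤_) (cong (λ x → D n ℕ.* (D n ℕ.* x)) (sym (ℕ.*-identityʳ (D n))))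
            (Comparison.q′≤D³ (p k) (P n) (D n) (q k) (q (suc k)) (At.8≤D n) qₖ≤D² D²<qₖ₊₁ p≡P q≡D (proj₂ equation))
        where
        equation : p k ℤ.* + D n ≡ + P n ℤ.* + q k ×
                   + R n ℤ.* + (q k ℕ.* q (suc k)) ℤ.≤ (p k ℤ.* + q (suc k) ℤ.+ + 1) ℤ.* + F n
        equation = convergent-equation n k qₖ≤D² D²<qₖ₊₁

        same : (p k ℚ./ q k) {{denominator-nonZero k}} ≡ (+ P n ℚ./ D n) {{D≢0 n}}
        same = /-≡ (p k) (+ P n) (q k) (D n) {{denominator-nonZero k}} {{D≢0 n}} (proj₁ equation)

        q≡D : q k ≡ D n
        q≡D = trans (sym (↧-coprime (p k) (q k) {{denominator-nonZero k}} (coprime k)))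
          (trans (cong ↧ₙ_ same) (↧-coprime (+ P n) (D n) {{D≢0 n}} P⊥D))

        p≡P : p k ≡ + P n
        p≡P = trans (sym (↥-coprime (p k) (q k) {{denominator-nonZero k}} (coprime k)))
          (trans (cong ↥_ same) (↥-coprime (+ P n) (D n) {{D≢0 n}} P⊥D))

  ξ∉Strong : ¬ StrongLiouville ξ
  ξ∉Strong (_ , c , c→ξ , strong) = go (strong 3 (ℕ.s≤s ℕ.z≤n))
    where
    open ContinuedFraction c renaming (denominator to q)
    open Convergents c

    contradiction : ∀ N → (∀ k → k ℕ.> N → q (suc k) ℕ.> q k ℕ.^ 3) →
      ∀ n → q N ℕ.< D n → ∃[ k ] (q k ≡ D n × q (suc k) ℕ.≤ D n ℕ.^ 3) → ⊥
    contradiction N big n qN<D (k , qₖ≡D , qₖ₊₁≤D³) =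
      ℕ.<⇒≱ (big k (ℕ.≰⇒> λ k≤N → ℕ.<⇒≱ qN<D (subst (ℕ._≤ q N) qₖ≡D (q-mono k≤N))))
        (subst (λ d → q (suc k) ℕ.≤ d ℕ.^ 3) (sym qₖ≡D) qₖ₊₁≤D³)

    go : ∃[ N ] (∀ k → k ℕ.> N → q (suc k) ℕ.> q k ℕ.^ 3) → ⊥
    -- As D n > n, the stage `suc (q N)` has D > q N, so by monotonicity of q the index at which D
    -- occurs lies beyond N. The successor form is the one that `P⊥D` covers.
    go (N , big) = contradiction N big (suc (q N)) (ℕ.<-trans (ℕ.n<1+n (q N)) (n<D (suc (q N))))
      (D-is-denominator c c→ξ (suc (q N)) (P⊥D (q N)))

mainTheorem2 : (StrongLiouville ⊆ 𝓛) × Uncountable (𝓛 ∖ StrongLiouville)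
mainTheorem2 = (λ { {ξ} (_ , c , c→ξ , strong) → StrongLiouvilleExpansion.strong⇒𝓛 {ξ} c c→ξ strong })
  , λ { (f , lists) → let open Diagonal f; n , ξ≃fn = lists {ξ} (ξ∈𝓛 , ξ∉Strong) in ξ≄f n ξ≃fn }
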